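{- Let $H=(V,E)$ be a hypergraph on $n$ vertices with $m$ edges and with the property that no edge contains another. Let $Z(H)$ be the set of all versals of $H$. Then the cardinality of $Z(H)$ is at least $n+1$ unless $H$ is (a) the set of all singletons $S_n$, (b) the set of all complements of singletons $\widetilde{S}_n$, (c) the graph $C_4$ (the four-cycle). In those cases, the cardinality of $Z(H)$ is $n$.
   Context: A hypergraph $H=(V,E)$ on $n$ vertices and $m$ edges consists of a vertex set $V$ with $|V|=n$ and a set $E$ of $m$ subsets of $V$ (the edges). A set of vertices $S\subseteq V$ is a versal for the edge $e\in E$ if for every other edge $f\in E$, $$|e|+|S\cap e|<|f|+|S\cap f|.$$ $L(e)=L(H,e)$ denotes the set of all versals for the edge $e$, and $Z(H)=\bigcup\{L(e)\mid e\in E\}$ is the set of all versals. $S_n$ is the hypergraph on $n$ vertices whose edges are the sets $\{v\}$, $v\in V$; $\widetilde{S}_n$ is the hypergraph on $n$ vertices whose edges are the sets $V\setminus\{v\}$, $v\in V$; and $C_4$ is the four-cycle graph, with $V=\{v_1,v_2,v_3,v_4\}$ and edges $\{v_1,v_2\},\{v_2,v_3\},\{v_3,v_4\},\{v_4,v_1\}$.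
   Formalization: The bound n+1 is stated for hypergraphs with at least one edge (with no edges Z(H) is empty), and the equality |Z(H)| = n excludes n = 1 (there S_1 and its complement version have one edge and 2 versals). -}

module Defs where

open import Data.Bool.Properties using () renaming (_≟_ to _≟ᵇ_; not-injective to not-inj)
open import Data.Fin using (Fin)
open import Data.Fin.Patterns using (0F; 1F; 2F; 3F)
open import Data.Fin.Permutation using (Permutation; _⟨$⟩ˡ_)
open import Data.Fin.Subset
  using (Subset; inside; outside; ⁅_⁆; ∁; _∪_; _∩_; _⊆_; ∣_∣)
  renaming (_∈_ to _∈ˢ_)
open import Data.Fin.Subset.Properties using (x∈⁅x⁆; x∈⁅y⁆⇒x≡y)
open import Data.List as List using (List; []; _∷_; _++_; length; filter)
import Data.List.Membership.Propositional as ListMem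
open import Data.List.Membership.Propositional.Properties
  using (∈-++⁺ˡ; ∈-++⁺ʳ; ∈-map⁺; ∈-map⁻)
import Data.List.Relation.Unary.All as ListAll
import Data.List.Relation.Unary.AllPairs as ListAllPairs
open import Data.List.Relation.Unary.Any using (here)
import Data.List.Relation.Unary.Unique.Propositional as ListUnique
import Data.List.Relation.Unary.Unique.Propositional.Properties as ListUniqueₚ
open import Data.Nat using (ℕ; zero; suc; _+_; _<_; _<?_)
open import Data.Product using (∃-syntax; _×_; _,_)
open import Data.Vec using (Vec; []; _∷_; lookup; tabulate)
open import Data.Vec.Membership.Propositional using (_∈_)
open import Data.Vec.Membership.Propositional.Properties using (fromAny; toAny)
open import Data.Vec.Properties using (≡-dec; ∷-injectiveˡ; ∷-injectiveʳ)
open import Data.Vec.Relation.Unary.All as All using (All; []; _∷_)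
import Data.Vec.Relation.Unary.AllPairs as AllPairs
import Data.Vec.Relation.Unary.Any as Any
open import Data.Vec.Relation.Unary.Unique.Propositional using (Unique)
import Data.Vec.Relation.Unary.Unique.Propositional.Properties as Uniqueₚ
open import Function using (_⇔_; _∘_)
open import Relation.Binary.Definitions using (DecidableEquality)
open import Relation.Binary.PropositionalEquality
  using (_≡_; _≢_; refl; subst; cong₂)
open import Relation.Nullary.Decidable as Dec using (¬?; _→-dec_; from-yes)
open import Relation.Nullary.Negation using (¬_)
open import Relation.Unary using (Pred; Decidable)
open import Level using (0ℓ)

-- The vertex set is Fin n.  The order in which the m distinct edges are
-- listed is irrelevant: everything below depends only on membership.
record Hypergraph (n m : ℕ) : Set where
  constructor mkHypergraph
  field
    edges  : Vec (Subset n) m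
    unique : Unique edges

open Hypergraph public

private
  variable
    n m n′ m′ : ℕ

NoEdgeContainsAnother : Hypergraph n m → Set
NoEdgeContainsAnother H =
  ∀ {e f} → e ∈ edges H → f ∈ edges H → e ≢ f → ¬ (e ⊆ f)

_≟ˢ_ : DecidableEquality (Subset n)
_≟ˢ_ = ≡-dec _≟ᵇ_

-- The set of versals for e.  Meant for e ∈ edges H.
L : Hypergraph n m → Subset n → Pred (Subset n) 0ℓ
L H e S =
  ∀ {f} → f ∈ edges H → f ≢ e → ∣ e ∣ + ∣ S ∩ e ∣ < ∣ f ∣ + ∣ S ∩ f ∣

Z : Hypergraph n m → Pred (Subset n) 0ℓ
Z H S = ∃[ e ] e ∈ edges H × L H e S

private
  all⁺ : ∀ {A : Set} {P : Pred A 0ℓ} {k} {xs : Vec A k} →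
         (∀ {x} → x ∈ xs → P x) → All P xs
  all⁺ {xs = []}     p = []
  all⁺ {xs = _ ∷ _} p = p (Any.here refl) ∷ all⁺ (p ∘ Any.there)

L? : (H : Hypergraph n m) (e : Subset n) → Decidable (L H e)
L? H e S = Dec.map′ (λ ps → All.lookup ps) all⁺
  (All.all? (λ f → ¬? (f ≟ˢ e) →-dec
                   (∣ e ∣ + ∣ S ∩ e ∣ <? ∣ f ∣ + ∣ S ∩ f ∣)) (edges H))

Z? : (H : Hypergraph n m) → Decidable (Z H)
Z? H S = Dec.map′ fromAny (λ (_ , e∈H , S∈Le) → toAny e∈H S∈Le)
  (Any.any? (λ e → L? H e S) (edges H))

allSubsets : (n : ℕ) → List (Subset n)
allSubsets zero  = [] ∷ []
allSubsets (suc n) =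
  List.map (outside ∷_) (allSubsets n) ++ List.map (inside ∷_) (allSubsets n)

∈-allSubsets : (S : Subset n) → S ListMem.∈ allSubsets n
∈-allSubsets []                = here refl
∈-allSubsets (outside ∷ S) =
  ∈-++⁺ˡ (∈-map⁺ (outside ∷_) (∈-allSubsets S))
∈-allSubsets {suc n} (inside ∷ S) =
  ∈-++⁺ʳ (List.map (outside ∷_) (allSubsets n)) (∈-map⁺ (inside ∷_) (∈-allSubsets S))

allSubsets-unique : ∀ n → ListUnique.Unique (allSubsets n)
allSubsets-unique zero  = ListAll.[] ListAllPairs.∷ ListAllPairs.[]
allSubsets-unique (suc n) = ListUniqueₚ.++⁺
  (ListUniqueₚ.map⁺ ∷-injectiveʳ (allSubsets-unique n))
  (ListUniqueₚ.map⁺ ∷-injectiveʳ (allSubsets-unique n))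
  λ (p , q) → disjoint (∈-map⁻ (outside ∷_) p) (∈-map⁻ (inside ∷_) q)
  where
  disjoint : ∀ {T : Subset (suc n)} →
             ∃[ S ] (S ListMem.∈ allSubsets n × T ≡ outside ∷ S) →
             ¬ (∃[ S ] (S ListMem.∈ allSubsets n × T ≡ inside ∷ S))
  disjoint (_ , _ , refl) (_ , _ , ())

-- The cardinality of Z H, as allSubsets n lists every subset exactly once.
∣Z_∣ : Hypergraph n m → ℕ
∣Z_∣ {n} H = length (filter (Z? H) (allSubsets n))

image : Permutation n n′ → Subset n → Subset n′
image π S = tabulate (λ v → lookup S (π ⟨$⟩ˡ v))

infix 4 _≅_

_≅_ : Hypergraph n m → Hypergraph n′ m′ → Set
_≅_ {n} {n′ = n′} G H =
  ∃[ π ] (∀ e → e ∈ edges G ⇔ image {n} {n′} π e ∈ edges H)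

private
  ⁅⁆-injective : {u v : Fin n} → ⁅ u ⁆ ≡ ⁅ v ⁆ → u ≡ v
  ⁅⁆-injective {u = u} {v} eq = x∈⁅y⁆⇒x≡y v (subst (u ∈ˢ_) eq (x∈⁅x⁆ u))

  ∁-injective : {S T : Subset n} → ∁ S ≡ ∁ T → S ≡ T
  ∁-injective {S = []}    {[]}    _  = refl
  ∁-injective {S = _ ∷ _} {_ ∷ _} eq =
    cong₂ _∷_ (not-inj (∷-injectiveˡ eq)) (∁-injective (∷-injectiveʳ eq))

Singletons : (n : ℕ) → Hypergraph n n
Singletons n = mkHypergraph (tabulate ⁅_⁆) (Uniqueₚ.tabulate⁺ ⁅⁆-injective)

CoSingletons : (n : ℕ) → Hypergraph n n
CoSingletons n = mkHypergraph (tabulate (∁ ∘ ⁅_⁆))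
                    (Uniqueₚ.tabulate⁺ (⁅⁆-injective ∘ ∁-injective))

C₄ : Hypergraph 4 4
C₄ = mkHypergraph es (from-yes (AllPairs.allPairs? (λ e f → ¬? (e ≟ˢ f)) es))
  where
  es : Vec (Subset 4) 4
  es = (⁅ 0F ⁆ ∪ ⁅ 1F ⁆) ∷ (⁅ 1F ⁆ ∪ ⁅ 2F ⁆) ∷ (⁅ 2F ⁆ ∪ ⁅ 3F ⁆) ∷ (⁅ 3F ⁆ ∪ ⁅ 0F ⁆) ∷ []

{-# OPTIONS --safe #-}

-- Call T light if its complement is versal.  An edge e of minimal size is light, and
-- so is e with a vertex x flipped, unless exchanging x with some vertex turns e into
-- another edge of minimal size.  Fix such an e₀ and join two vertices if exchanging
-- them in e₀ gives an edge of minimal size.  Take a maximal matching of this graph,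
-- and attach each unmatched non-isolated vertex u to a matched neighbour.  Distinct
-- light sets are then e₀ itself, e₀ with an isolated vertex flipped, e₀ with u and its
-- neighbour flipped, e₀ with a matched pair flipped, and for each matched pair one
-- more set, obtained by moving a target vertex t in e₀ with the pair flipped: this
-- makes n + 1.  The last sets are new if t is not attached to the pair and no two
-- pairs have targets in each other.  Such targets exist, or another light set does,
-- unless the graph is a star spanning V (giving the singletons or their complements)
-- or consists of two disjoint edges covering V (giving C₄).
module Submission where

open import Defs
open import Algebra.Properties.CommutativeMonoid.Sum using (sum; sum-permute; sum-cong-≗)
open import Data.Bool using (Bool; true; false; not; if_then_else_; _∧_)
open import Data.Bool.Properties using (not-injective; not-involutive; not-¬; ¬-not) renaming (_≟_ to _≟ᵇ_)
open import Data.Fin using (Fin; zero; suc; punchIn)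
open import Data.Fin.Patterns using (0F; 1F; 2F; 3F)
open import Data.Fin.Permutation as Perm
  using (Permutation; permutation; _⟨$⟩ʳ_; _⟨$⟩ˡ_; inverseˡ; inverseʳ; ↔⇒≡)
open import Data.Fin.Properties using (_≟_; any?; all?; suc-injective; punchInᵢ≢i; injective⇒≤)
open import Data.Fin.Subset using (Subset; ⁅_⁆; ∁; _∩_; ∣_∣; inside; outside)
  renaming (_∈_ to _∈ˢ_; _⊆_ to _⊆ˢ_)
open import Data.Fin.Subset.Properties
  using (∣⁅x⁆∣≡1; ∩-zeroʳ; ∣⊥∣≡0; _⊆?_; _∈?_; ∣∁p∣≡n∸∣p∣; x∈⁅x⁆; x∈⁅y⁆⇒x≡y; x∉p⇒x∈∁p)
open import Data.List as List using (List; []; _∷_; foldr; filter)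
import Data.List.Membership.DecPropositional as DecMembership
open import Data.List.Membership.Propositional using (_∈_; _∉_; find; lose)
import Data.List.Membership.Propositional.Properties as Membershipₚ
import Data.List.Membership.Setoid.Properties as SetoidMemₚ
open import Data.List.Relation.Binary.Subset.Propositional using (_⊆_)
open import Data.List.Relation.Unary.All as All using (All; []; _∷_)
open import Data.List.Relation.Unary.All.Properties using (All¬⇒¬Any; ¬Any⇒All¬)
open import Data.List.Relation.Unary.AllPairs using ([]; _∷_)
open import Data.List.Relation.Unary.Any as Any using (here; there)
import Data.List.Relation.Unary.Any.Properties as Anyₚ
open import Data.List.Relation.Unary.Unique.Propositional using (Unique)
import Data.List.Relation.Unary.Unique.Propositional.Properties as Uniqueₚ
open import Data.Maybe using (Maybe; just; nothing)
open import Data.Nat as ℕ using (ℕ; _+_; _∸_; _≤_; _<_; z≤n; s≤s; _≤?_)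
open import Data.Nat.Properties
  using (+-0-commutativeMonoid; +-comm; +-suc; +-assoc; +-identityʳ; +-cancelˡ-≡; +-cancelʳ-≡; +-cancelˡ-≤;
         ≤-refl; ≤-reflexive; ≤-trans; ≤-antisym; ≤-total; m≤m+n; ≰⇒>; <⇒≱; <-irrefl; <-asym; n≤0⇒n≡0; m+1+n≢m)
import Data.Nat.Properties as ℕₚ
open import Data.Product using (∃; ∃-syntax; _×_; _,_; proj₁; proj₂)
open import Data.Sum using (_⊎_; inj₁; inj₂; [_,_]′)
open import Data.Vec using (Vec; []; _∷_; lookup; updateAt)
open import Data.Vec.Membership.Propositional using () renaming (_∈_ to _∈ᵛ_)
open import Data.Vec.Membership.Propositional.Properties using (fromAny; toAny; ∈-tabulate⁺)
open import Data.Vec.Properties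
  using (updateAt-updateAt-local; updateAt-id-local; updateAt-commutes; lookup∘updateAt; lookup∘updateAt′;
         lookup∘tabulate; lookup-zipWith; tabulate∘lookup; lookup-map; []=⇒lookup; lookup⇒[]=)
open import Data.Vec.Relation.Unary.Any as VecAny using (here; there)
import Data.Vec.Relation.Unary.Any.Properties as VecAnyₚ
open import Function using (_∘_; id; _⇔_; mk⇔; Equivalence)
open import Function.Definitions using (Injective)
open import Level using (0ℓ)
open import Relation.Binary.PropositionalEquality
  using (_≡_; _≢_; refl; sym; trans; cong; cong₂; subst; subst₂; ≢-sym; setoid; module ≡-Reasoning)
open import Relation.Nullary using (¬_; yes; no; contradiction; Dec)
open import Relation.Nullary.Decidable using (¬?; _×-dec_; _⊎-dec_; decidable-stable; from-yes; map′)
open import Relation.Unary using (Pred; Decidable)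

private
  variable
    n m n′ m′ : ℕ

-- Flipping the membership of listed vertices.

flip : Fin n → Subset n → Subset n
flip x S = updateAt S x not

infixl 6 _⊕_

-- The flipped vertices form a list, so that comparing two sets becomes membership in short explicit
-- lists. A vertex listed twice cancels.
_⊕_ : Subset n → List (Fin n) → Subset n
S ⊕ xs = foldr flip S xs

flip-involutive : ∀ (x : Fin n) S → flip x (flip x S) ≡ S
flip-involutive x S =
  trans (updateAt-updateAt-local x {h = id} S (not-involutive (lookup S x)))
        (updateAt-id-local x S refl)

flip-comm : ∀ (x y : Fin n) S → flip x (flip y S) ≡ flip y (flip x S)
flip-comm x y S with x ≟ y
... | yes refl = refl
... | no x≢y   = updateAt-commutes x y x≢y S

⊕-cancel : ∀ (S : Subset n) x y zs → S ⊕ (x ∷ y ∷ x ∷ zs) ≡ S ⊕ (y ∷ zs)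
⊕-cancel S x y zs = trans (flip-comm x y _) (cong (flip y) (flip-involutive x _))

lookup-⊕-∉ : ∀ (S : Subset n) {xs x} → x ∉ xs → lookup (S ⊕ xs) x ≡ lookup S x
lookup-⊕-∉ S {[]}     _ = refl
lookup-⊕-∉ S {z ∷ xs} x∉ =
  trans (lookup∘updateAt′ _ z (x∉ ∘ here) (S ⊕ xs)) (lookup-⊕-∉ S (x∉ ∘ there))

lookup-⊕-∈ : ∀ (S : Subset n) {xs x} → Unique xs → x ∈ xs → lookup (S ⊕ xs) x ≡ not (lookup S x)
lookup-⊕-∈ S {z ∷ xs} (z# ∷ _) (here refl) =
  trans (lookup∘updateAt z (S ⊕ xs)) (cong not (lookup-⊕-∉ S (All¬⇒¬Any z#)))
lookup-⊕-∈ S {z ∷ xs} {x} (z# ∷ u) (there x∈) =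
  trans (lookup∘updateAt′ x z x≢z (S ⊕ xs)) (lookup-⊕-∈ S u x∈)
  where
  x≢z : x ≢ z
  x≢z refl = All¬⇒¬Any z# x∈

-- Without repetitions every vertex of `xs` really changes, while `S ⊕ ys` differs from `S` only
-- inside `ys`. Light sets are told apart by this.
⊕-reflects-⊆ : ∀ (S : Subset n) {xs ys} → Unique xs → S ⊕ xs ≡ S ⊕ ys → xs ⊆ ys
⊕-reflects-⊆ S {xs} {ys} u eq {x} x∈xs with DecMembership._∈?_ _≟_ x ys
... | yes x∈ys = x∈ys
... | no  x∉ys = contradiction
  (trans (sym (lookup-⊕-∉ S x∉ys)) (trans (cong (λ T → lookup T x) (sym eq)) (lookup-⊕-∈ S u x∈xs)))
  (not-¬ refl)

pattern at₂ = there (here refl)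
pattern at₃ = there (there (here refl))
pattern at₄ = there (there (there (here refl)))

lookup-ext : ∀ {S T : Subset n} → (∀ x → lookup S x ≡ lookup T x) → S ≡ T
lookup-ext {S = []}    {[]}    _  = refl
lookup-ext {S = _ ∷ _} {_ ∷ _} eq = cong₂ _∷_ (eq zero) (lookup-ext (eq ∘ suc))

∈₁ : ∀ {x y : Fin n} → x ∈ y ∷ [] → x ≡ y
∈₁ (here x≡y) = x≡y

∈₂ : ∀ {x y z : Fin n} → x ∈ y ∷ z ∷ [] → x ≡ y ⊎ x ≡ z
∈₂ (here x≡y)  = inj₁ x≡y
∈₂ (there x∈) = inj₂ (∈₁ x∈)

unique₂ : ∀ {x y : Fin n} → x ≢ y → Unique (x ∷ y ∷ [])
unique₂ x≢y = (x≢y ∷ []) ∷ [] ∷ []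

-- Maximal matchings and pairings.

-- Maximal matchings of a decidable graph on Fin n, as involutions whose
-- fixed points are the unmatched vertices.
record MaximalMatching {n} (_~_ : Fin n → Fin n → Set) : Set where
  field
    mate       : Fin n → Fin n
    involutive : ∀ x → mate (mate x) ≡ x
    adjacent   : ∀ {x} → mate x ≢ x → x ~ mate x
    maximal    : ∀ {x y} → mate x ≡ x → mate y ≡ y → ¬ (x ~ y)

module _ where
  open MaximalMatching

  -- Recursion on the number of vertices: the vertices other than `zero` are matched first, then
  -- `zero` is joined to an unmatched neighbour if one is left.
  maximalMatching : ∀ {n} {_~_ : Fin n → Fin n → Set} →
                    (∀ x y → Dec (x ~ y)) → (∀ {x y} → x ~ y → y ~ x) → (∀ {x} → ¬ (x ~ x)) →
                    MaximalMatching _~_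
  maximalMatching {ℕ.zero} _ _ _ = record
    { mate = id ; involutive = λ () ; adjacent = λ {} ; maximal = λ {} }
  maximalMatching {ℕ.suc n} {_~_} ~? ~-sym ~-irrefl = extend (any? λ w → (q w ≟ w) ×-dec ~? zero (suc w))
    where
    M = maximalMatching {n} {λ x y → suc x ~ suc y} (λ x y → ~? (suc x) (suc y)) ~-sym ~-irrefl
    q = mate M

    extend : Dec (∃[ w ] q w ≡ w × zero ~ suc w) → MaximalMatching _~_
    extend (no ¬w) = record { mate = q′ ; involutive = inv ; adjacent = adj ; maximal = max }
      where
      q′ : Fin (ℕ.suc n) → Fin (ℕ.suc n)
      q′ zero    = zero
      q′ (suc x) = suc (q x)
      inv : ∀ x → q′ (q′ x) ≡ x
      inv zero    = refl
      inv (suc x) = cong suc (involutive M x)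
      adj : ∀ {x} → q′ x ≢ x → x ~ q′ x
      adj {zero}  h = contradiction refl h
      adj {suc x} h = adjacent M (h ∘ cong suc)
      max : ∀ {x y} → q′ x ≡ x → q′ y ≡ y → ¬ (x ~ y)
      max {zero}  {zero}  _ _ = ~-irrefl
      max {zero}  {suc y} _ k e = ¬w (y , suc-injective k , e)
      max {suc x} {zero}  h _ e = ¬w (x , suc-injective h , ~-sym e)
      max {suc x} {suc y} h k = maximal M (suc-injective h) (suc-injective k)
    extend (yes (w , qw≡w , 0~w)) = record { mate = q′ ; involutive = inv ; adjacent = adj ; maximal = max }
      where
      q′ : Fin (ℕ.suc n) → Fin (ℕ.suc n)
      q′ zero = suc w
      q′ (suc x) with x ≟ w
      ... | yes _ = zero
      ... | no  _ = suc (q x)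
      q′-suc : ∀ {x} → x ≢ w → q′ (suc x) ≡ suc (q x)
      q′-suc {x} x≢w with x ≟ w
      ... | yes x≡w = contradiction x≡w x≢w
      ... | no  _   = refl
      q′-w : q′ (suc w) ≡ zero
      q′-w with w ≟ w
      ... | yes _  = refl
      ... | no w≢w = contradiction refl w≢w
      inv : ∀ x → q′ (q′ x) ≡ x
      inv zero = q′-w
      inv (suc x) with x ≟ w
      ... | yes refl = refl
      ... | no x≢w = trans (q′-suc λ qx≡w → x≢w (trans (sym (involutive M x)) (trans (cong q qx≡w) qw≡w)))
                           (cong suc (involutive M x))
      adj : ∀ {x} → q′ x ≢ x → x ~ q′ x
      adj {zero} _ = 0~w
      adj {suc x} h with x ≟ w
      ... | yes refl = ~-sym 0~w
      ... | no _ = adjacent M (h ∘ cong suc)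
      fixed : ∀ {x} → q′ (suc x) ≡ suc x → q x ≡ x
      fixed {x} h with x ≟ w
      ... | no _ = suc-injective h
      max : ∀ {x y} → q′ x ≡ x → q′ y ≡ y → ¬ (x ~ y)
      max {suc x} {suc y} h k = maximal M (fixed h) (fixed k)

-- A maximal matching, completed by joining every unmatched non-isolated
-- vertex to one of its neighbours, which is matched.
record Pairing {n} (_~_ : Fin n → Fin n → Set) : Set where
  field
    p          : Fin n → Fin n
    p³≡p       : ∀ x → p (p (p x)) ≡ p x
    p-adjacent : ∀ {x} → p x ≢ x → x ~ p x
    p-isolated : ∀ {x} → p x ≡ x → ∀ y → ¬ (x ~ y)

pairing : ∀ {n} {_~_ : Fin n → Fin n → Set} →
          (∀ x y → Dec (x ~ y)) → (∀ {x y} → x ~ y → y ~ x) → (∀ {x} → ¬ (x ~ x)) → Pairing _~_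
pairing {n} {_~_} ~? ~-sym ~-irrefl =
  record { p = proj₁ ∘ choice ; p³≡p = p³ ; p-adjacent = adj ; p-isolated = iso }
  where
  open MaximalMatching (maximalMatching ~? ~-sym ~-irrefl)

  data Role (x : Fin n) : Fin n → Set where
    matched   : mate x ≢ x → Role x (mate x)
    isolated  : (∀ y → ¬ (x ~ y)) → Role x x
    unmatched : ∀ {y} → mate x ≡ x → x ~ y → Role x y

  choice : ∀ x → ∃ (Role x)
  choice x with mate x ≟ x | any? (~? x)
  ... | no  m  | _             = _ , matched m
  ... | yes _  | no none       = _ , isolated λ y e → none (y , e)
  ... | yes m  | yes (y , x~y) = y , unmatched m x~y

  p = proj₁ ∘ choice

  role : ∀ x → Role x (p x)
  role = proj₂ ∘ choice

  p-matched : ∀ {x} → mate x ≢ x → p x ≡ mate x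
  p-matched {x} h = go (role x)
    where
    go : ∀ {y} → Role x y → y ≡ mate x
    go (matched _)      = refl
    go (isolated none)  = contradiction (adjacent h) (none _)
    go (unmatched fx _) = contradiction fx h

  mate-moves : ∀ {x} → mate x ≢ x → mate (mate x) ≢ mate x
  mate-moves {x} h eq = h (trans (sym eq) (involutive x))

  -- `p` swaps matched vertices and fixes isolated ones, so it suffices that `p x` is always of one
  -- of these kinds. For unmatched `x` with a neighbour this is maximality.
  p³ : ∀ x → p (p (p x)) ≡ p x
  p³ x = go refl (role x)
    where
    go : ∀ {y} → p x ≡ y → Role x y → p (p y) ≡ y
    go px≡x (isolated _) = trans (cong p px≡x) px≡x
    go _    (matched h)  =
      trans (cong p (trans (p-matched (mate-moves h)) (involutive x))) (p-matched h)
    go {y} _ (unmatched fx x~y) =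
      trans (cong p (p-matched h)) (trans (p-matched (mate-moves h)) (involutive y))
      where
      h : mate y ≢ y
      h fy = maximal fx fy x~y

  adj : ∀ {x} → p x ≢ x → x ~ p x
  adj {x} px≢x = go px≢x (role x)
    where
    go : ∀ {y} → y ≢ x → Role x y → x ~ y
    go _   (matched h)       = adjacent h
    go x≢x (isolated _)      = contradiction refl x≢x
    go _   (unmatched _ x~y) = x~y

  iso : ∀ {x} → p x ≡ x → ∀ y → ¬ (x ~ y)
  iso {x} px≡x = go px≡x (role x)
    where
    go : ∀ {y} → y ≡ x → Role x y → ∀ z → ¬ (x ~ z)
    go mx≡x (matched h)        = contradiction mx≡x h
    go _    (isolated none)    = none
    go refl (unmatched _ x~x)  = contradiction x~x ~-irrefl

-- Light sets around a fixed edge of minimal size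

∃-subset? : ∀ {n} {P : Pred (Subset n) 0ℓ} → Decidable P → Dec (∃ P)
∃-subset? {n} P? = map′ (λ a → let S , _ , PS = find a in S , PS) (λ (S , PS) → lose (∈-allSubsets S) PS)
  (Any.any? P? (allSubsets n))

-- The singleton of `x` for `c = true`, its complement for `c = false`: one notion for both
-- exceptional families.
OnlyAt : ∀ {n} → Bool → Fin n → Pred (Subset n) 0ℓ
OnlyAt c x T = lookup T x ≡ c × (∀ w → w ≢ x → lookup T w ≡ not c)

-- In the application C consists of the edges of minimal size, and Y of the sets
-- whose complement is versal.
module Counting {n} {C Y : Pred (Subset n) 0ℓ}
  (C? : Decidable C) (Y? : Decidable Y) (C⊆Y : ∀ {T} → C T → Y T)
  (step : ∀ {T} → C T → ∀ x → Y (flip x T) ⊎ (∃[ w ] w ≢ x × C (flip w (flip x T))))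
  {e₀ : Subset n} (e₀∈C : C e₀)
  (balanced : ∀ {x y} → x ≢ y → C (e₀ ⊕ (x ∷ y ∷ [])) → lookup e₀ x ≢ lookup e₀ y)
  where

  -- `Maybe (Fin n)` serves as an index set of n + 1 elements: `nothing` will index `e₀`, and
  -- `just x` a set assigned to the vertex `x`.
  Plenty : Set
  Plenty = ∃[ g ] Injective {A = Maybe (Fin n)} _≡_ _≡_ g × (∀ v → Y (g v))

  _~_ : Fin n → Fin n → Set
  x ~ y = x ≢ y × C (e₀ ⊕ (x ∷ y ∷ []))

  ~-sym : ∀ {x y} → x ~ y → y ~ x
  ~-sym {x} {y} (x≢y , c) = ≢-sym x≢y , subst C (flip-comm x y e₀) c

  opaque
    pairing~ : Pairing _~_
    pairing~ = pairing (λ x y → ¬? (x ≟ y) ×-dec C? _) ~-sym (λ (x≢x , _) → x≢x refl)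

  open Pairing pairing~

  private
    variable
      x y y′ a b t a′ b′ t′ : Fin n
      T T′ : Subset n

  -- The members of Y given to all vertices but the heads of matched pairs; colours
  -- (membership in e₀) differ along _~_, so each matched pair has one head.
  data PairView (x : Fin n) : List (Fin n) → Set where
    solo : p x ≡ x → PairView x (x ∷ [])
    duo  : p x ≢ x → PairView x (x ∷ p x ∷ [])

  pairView : ∀ x → ∃ (PairView x)
  pairView x with p x ≟ x
  ... | yes px≡x = _ , solo px≡x
  ... | no  px≢x = _ , duo px≢x

  pair : Fin n → List (Fin n)
  pair = proj₁ ∘ pairView

  pair⊆ : ∀ x → pair x ⊆ x ∷ p x ∷ []
  pair⊆ x {z} = go (proj₂ (pairView x))
    where
    go : ∀ {xs} → PairView x xs → z ∈ xs → z ∈ x ∷ p x ∷ []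
    go (solo _) (here eq) = here eq
    go (duo _)  z∈        = z∈

  pair-Y : ∀ x → Y (e₀ ⊕ pair x)
  pair-Y x = go (proj₂ (pairView x))
    where
    go : ∀ {xs} → PairView x xs → Y (e₀ ⊕ xs)
    go (duo px≢x) = C⊆Y (proj₂ (p-adjacent px≢x))
    go (solo px≡x) with step e₀∈C x
    ... | inj₁ x∈Y            = x∈Y
    ... | inj₂ (w , w≢x , c) = contradiction (~-sym (w≢x , c)) (p-isolated px≡x w)

  Head : Fin n → Set
  Head y = p y ≢ y × p (p y) ≡ y × lookup e₀ y ≡ true

  head? : Decidable Head
  head? y = ¬? (p y ≟ y) ×-dec (p (p y) ≟ y) ×-dec (lookup e₀ y ≟ᵇ true)

  ¬both-heads : Head y → Head y′ → p y ≢ y′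
  ¬both-heads (py≢y , _ , c) (_ , _ , c′) refl =
    balanced (≢-sym py≢y) (proj₂ (p-adjacent py≢y)) (trans c (sym c′))

  -- Different vertices with the same set are matched with each other; balance then gives them
  -- different colours, which makes one of them a head.
  pair-injective : ∀ {x x′} → ¬ Head x → ¬ Head x′ → e₀ ⊕ pair x ≡ e₀ ⊕ pair x′ → x ≡ x′
  pair-injective {x} {x′} ¬h ¬h′ = go (proj₂ (pairView x)) (proj₂ (pairView x′))
    where
    nonhead-color : ∀ {x} → p x ≢ x → p (p x) ≡ x → ¬ Head x → lookup e₀ x ≡ false
    nonhead-color px≢x p²x≡x ¬h = ¬-not λ c → ¬h (px≢x , p²x≡x , c)
    go : ∀ {xs xs′} → PairView x xs → PairView x′ xs′ → e₀ ⊕ xs ≡ e₀ ⊕ xs′ → x ≡ x′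
    go (solo _) (solo _) eq = ∈₁ (⊕-reflects-⊆ e₀ ([] ∷ []) eq (here refl))
    go (solo _) (duo h) eq = contradiction (trans (∈₁ (⊆′ at₂)) (sym (∈₁ (⊆′ (here refl))))) h
      where
      ⊆′ : x′ ∷ p x′ ∷ [] ⊆ x ∷ []
      ⊆′ = ⊕-reflects-⊆ e₀ (unique₂ (≢-sym h)) (sym eq)
    go (duo h) (solo _) eq = contradiction (trans (∈₁ (⊆′ at₂)) (sym (∈₁ (⊆′ (here refl))))) h
      where
      ⊆′ : x ∷ p x ∷ [] ⊆ x′ ∷ []
      ⊆′ = ⊕-reflects-⊆ e₀ (unique₂ (≢-sym h)) eq
    go (duo h) (duo h′) eq
      with ∈₂ (⊕-reflects-⊆ e₀ (unique₂ (≢-sym h)) eq (here refl))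
         | ∈₂ (⊕-reflects-⊆ e₀ (unique₂ (≢-sym h)) eq at₂)
    ... | inj₁ x≡x′   | _            = x≡x′
    ... | inj₂ x≡px′ | inj₂ px≡px′ = contradiction (trans px≡px′ (sym x≡px′)) h
    ... | inj₂ x≡px′ | inj₁ px≡x′   = contradiction
      (trans (nonhead-color h (trans (cong p px≡x′) (sym x≡px′)) ¬h)
        (trans (sym (nonhead-color h′ (trans (cong p (sym x≡px′)) px≡x′) ¬h′))
               (cong (lookup e₀) (sym px≡x′))))
      (balanced (≢-sym h) (proj₂ (p-adjacent h)))

  Good : Pred (Subset n) 0ℓ
  Good T = T ≢ e₀ × (∀ x → T ≢ e₀ ⊕ pair x)

  good? : Decidable Good
  good? T = ¬? (T ≟ˢ e₀) ×-dec all? (λ x → ¬? (T ≟ˢ (e₀ ⊕ pair x)))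

  -- The non-heads keep the sets `e₀ ⊕ pair x`, so all that is missing is a new member of `Y` for
  -- each head.
  byTokens : (tok : ∀ {y} → Head y → Subset n) →
             (∀ {y} (h : Head y) → Y (tok h)) → (∀ {y} (h : Head y) → Good (tok h)) →
             (∀ {y y′} (h : Head y) (h′ : Head y′) → tok h ≡ tok h′ → y ≡ y′) → Plenty
  byTokens tok tok-Y tok-good tok-injective = g , g-injective , g-Y
    where
    g : Maybe (Fin n) → Subset n
    g nothing = e₀
    g (just x) with head? x
    ... | yes h = tok h
    ... | no  _ = e₀ ⊕ pair x
    pair≢e₀ : ∀ x → e₀ ⊕ pair x ≢ e₀
    pair≢e₀ x = go (proj₂ (pairView x))
      where
      go : ∀ {xs} → PairView x xs → e₀ ⊕ xs ≢ e₀
      go (solo _) eq with ⊕-reflects-⊆ e₀ {ys = []} ([] ∷ []) eq (here refl)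
      ... | ()
      go (duo h) eq with ⊕-reflects-⊆ e₀ {ys = []} (unique₂ (≢-sym h)) eq (here refl)
      ... | ()
    just≢nothing : ∀ x → g (just x) ≢ e₀
    just≢nothing x with head? x
    ... | yes h = proj₁ (tok-good h)
    ... | no  _ = pair≢e₀ x
    g-injective : Injective _≡_ _≡_ g
    g-injective {nothing} {nothing} _  = refl
    g-injective {nothing} {just x}  eq = contradiction (sym eq) (just≢nothing x)
    g-injective {just x}  {nothing} eq = contradiction eq (just≢nothing x)
    g-injective {just x}  {just x′} eq with head? x | head? x′
    ... | yes h | yes h′ = cong just (tok-injective h h′ eq)
    ... | yes h | no  _  = contradiction eq (proj₂ (tok-good h) x′)
    ... | no _  | yes h′ = contradiction (sym eq) (proj₂ (tok-good h′) x)
    ... | no ¬h | no ¬h′ = cong just (pair-injective ¬h ¬h′ eq)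
    g-Y : ∀ v → Y (g v)
    g-Y nothing = C⊆Y e₀∈C
    g-Y (just x) with head? x
    ... | yes h = tok-Y h
    ... | no  _ = pair-Y x

  -- The outcomes of moving t in the neighbour e₀ ⊕ (a ∷ b ∷ []) of e₀: t alone is
  -- flipped, or it is exchanged with a or b (leaving the pair of t and the other
  -- one flipped), or with a fourth vertex w.
  data Token (a b t : Fin n) : Subset n → Set where
    triple : Token a b t (e₀ ⊕ (t ∷ a ∷ b ∷ []))
    edge   : ∀ {s} → s ∈ a ∷ b ∷ [] → Token a b t (e₀ ⊕ (s ∷ t ∷ []))
    quad   : ∀ {w} → w ∉ t ∷ a ∷ b ∷ [] → C (e₀ ⊕ (w ∷ t ∷ a ∷ b ∷ [])) →
             Token a b t (e₀ ⊕ (w ∷ t ∷ a ∷ b ∷ []))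

  move : a ~ b → ∀ t → ∃[ T ] Y T × Token a b t T
  move {a} {b} (a≢b , c) t with step c t
  ... | inj₁ i = _ , i , triple
  ... | inj₂ (w , w≢t , c′) with w ≟ a | w ≟ b
  ... | yes refl | _ = _ , C⊆Y (subst C eq c′) , edge at₂
    where
    eq : e₀ ⊕ (a ∷ t ∷ a ∷ b ∷ []) ≡ e₀ ⊕ (b ∷ t ∷ [])
    eq = trans (⊕-cancel e₀ a t (b ∷ [])) (flip-comm t b e₀)
  ... | no _ | yes refl = _ , C⊆Y (subst C eq c′) , edge (here refl)
    where
    eq : e₀ ⊕ (b ∷ t ∷ a ∷ b ∷ []) ≡ e₀ ⊕ (a ∷ t ∷ [])
    eq = trans (cong (flip b ∘ flip t) (flip-comm a b e₀))
               (trans (⊕-cancel e₀ b t (a ∷ [])) (flip-comm t a e₀))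
  ... | no w≢a | no w≢b = _ , C⊆Y c′ , quad (λ { (here eq) → w≢t eq
                                               ; (there (here eq)) → w≢a eq
                                               ; (there (there (here eq))) → w≢b eq }) c′

  record Fresh (a b t : Fin n) : Set where
    constructor fresh
    field
      a≢b : a ≢ b
      t∉  : t ∉ a ∷ b ∷ []

    unique-triple : Unique (t ∷ a ∷ b ∷ [])
    unique-triple = ¬Any⇒All¬ _ t∉ ∷ unique₂ a≢b

    unique-quad : ∀ {w} → w ∉ t ∷ a ∷ b ∷ [] → Unique (w ∷ t ∷ a ∷ b ∷ [])
    unique-quad w∉ = ¬Any⇒All¬ _ w∉ ∷ unique-triple

    unique-edge : ∀ {s} → s ∈ a ∷ b ∷ [] → Unique (s ∷ t ∷ [])
    unique-edge s∈ = unique₂ λ { refl → t∉ s∈ }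

  open Fresh

  target∈ : Fresh a b t → Token a b t T → ∀ {xs} → T ≡ e₀ ⊕ xs → t ∈ xs
  target∈ f triple eq      = ⊕-reflects-⊆ e₀ (unique-triple f) eq (here refl)
  target∈ f (edge s∈) eq   = ⊕-reflects-⊆ e₀ (unique-edge f s∈) eq at₂
  target∈ f (quad w∉ _) eq = ⊕-reflects-⊆ e₀ (unique-quad f w∉) eq at₂

  three⊈two : ∀ {x y z u v : Fin n} → Unique (x ∷ y ∷ z ∷ []) →
              x ∈ u ∷ v ∷ [] → y ∈ u ∷ v ∷ [] → ¬ (z ∈ u ∷ v ∷ [])
  three⊈two ((x≢y ∷ x≢z ∷ []) ∷ (y≢z ∷ []) ∷ _) x∈ y∈ z∈ with ∈₂ x∈ | ∈₂ y∈ | ∈₂ z∈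
  ... | inj₁ refl | inj₁ refl | _         = x≢y refl
  ... | inj₂ refl | inj₂ refl | _         = x≢y refl
  ... | inj₁ refl | inj₂ _    | inj₁ refl = x≢z refl
  ... | inj₂ refl | inj₁ _    | inj₂ refl = x≢z refl
  ... | inj₁ _    | inj₂ refl | inj₂ refl = y≢z refl
  ... | inj₂ _    | inj₁ refl | inj₁ refl = y≢z refl

  -- Triples and quads flip at least three vertices, the sets `pair x` at most two. An edge token
  -- flips `t` and some `s`, and equals a pair set only if `p` sends one of these to the other.
  token-good : Fresh a b t → (∀ {s} → s ∈ a ∷ b ∷ [] → p s ≢ t × p t ≢ s) → Token a b t T → Good T
  token-good {a} {b} {t} f unpaired τ = T≢e₀ , T≢pair τ
    where
    T≢e₀ : _ ≢ e₀
    T≢e₀ eq with target∈ f τ {[]} eq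
    ... | ()
    T≢pair : ∀ {T} → Token a b t T → ∀ x → T ≢ e₀ ⊕ pair x
    T≢pair triple x eq = three⊈two (unique-triple f) (in′ (here refl)) (in′ at₂) (in′ at₃)
      where
      in′ : _ ⊆ _
      in′ = pair⊆ x ∘ ⊕-reflects-⊆ e₀ (unique-triple f) eq
    T≢pair (quad w∉ _) x eq = three⊈two (unique-triple f) (in′ at₂) (in′ at₃) (in′ at₄)
      where
      in′ : _ ⊆ _
      in′ = pair⊆ x ∘ ⊕-reflects-⊆ e₀ (unique-quad f w∉) eq
    T≢pair (edge {s} s∈) x eq = go (∈₂ (in′ (here refl))) (∈₂ (in′ at₂))
      where
      in′ : s ∷ t ∷ [] ⊆ x ∷ p x ∷ []
      in′ = pair⊆ x ∘ ⊕-reflects-⊆ e₀ (unique-edge f s∈) eq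
      go : s ≡ x ⊎ s ≡ p x → ¬ (t ≡ x ⊎ t ≡ p x)
      go (inj₁ refl) (inj₁ refl) = t∉ f s∈
      go (inj₁ refl) (inj₂ t≡ps) = proj₁ (unpaired s∈) (sym t≡ps)
      go (inj₂ s≡pt) (inj₁ refl) = proj₂ (unpaired s∈) (sym s≡pt)
      go (inj₂ refl) (inj₂ refl) = t∉ f s∈

  -- If `a` and `b` both lie among `t′`, `a′`, `b′`, disjointness makes both equal to `t′`, which is
  -- absurd. This, or the same with the roles exchanged, settles all cases but two: equal edge
  -- tokens and equal quads force each target into the other pair.
  tokens-distinct : Fresh a b t → Fresh a′ b′ t′ →
    (∀ {s} → s ∈ a ∷ b ∷ [] → s ∉ a′ ∷ b′ ∷ []) →
    (t ∈ a′ ∷ b′ ∷ [] → t′ ∉ a ∷ b ∷ []) →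
    Token a b t T → Token a′ b′ t′ T′ → T ≢ T′
  tokens-distinct {a} {b} {t} {a′} {b′} {t′} f f′ disjoint ¬mutual = go
    where
    is-target : ∀ {a b a′ b′ s t : Fin n} → (∀ {s} → s ∈ a ∷ b ∷ [] → s ∉ a′ ∷ b′ ∷ []) →
              s ∈ a ∷ b ∷ [] → s ∈ t ∷ a′ ∷ b′ ∷ [] → s ≡ t
    is-target d s∈ (here eq)   = eq
    is-target d s∈ (there s∈′) = contradiction s∈′ (d s∈)
    disjoint′ : ∀ {s} → s ∈ a′ ∷ b′ ∷ [] → s ∉ a ∷ b ∷ []
    disjoint′ s∈′ s∈ = disjoint s∈ s∈′
    rotate : ∀ {s a b t : Fin n} {z : Fin n} → s ∈ a ∷ b ∷ [] → z ∈ s ∷ t ∷ [] → z ∈ t ∷ a ∷ b ∷ []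
    rotate s∈ (here refl) = there s∈
    rotate s∈ (there z∈)  = here (∈₁ z∈)
    -- As `a` and `b` avoid `a′` and `b′`, they are `w` and `t` in some order.
    hits : ∀ {a b a′ b′ t w : Fin n} → a ≢ b → (∀ {s} → s ∈ a ∷ b ∷ [] → s ∉ a′ ∷ b′ ∷ []) →
           a ∈ w ∷ t ∷ a′ ∷ b′ ∷ [] → b ∈ w ∷ t ∷ a′ ∷ b′ ∷ [] → t ∈ a ∷ b ∷ []
    hits a≢b d (here refl)        (here refl)        = contradiction refl a≢b
    hits a≢b d at₂ _                  = here refl
    hits a≢b d (there (there a∈)) _                   = contradiction a∈ (d (here refl))
    hits a≢b d (here _)           at₂ = there (here refl)
    hits a≢b d (here _)           (there (there b∈))  = contradiction b∈ (d at₂)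
    apart : ∀ {a b a′ b′ t : Fin n} → a ≢ b → (∀ {s} → s ∈ a ∷ b ∷ [] → s ∉ a′ ∷ b′ ∷ []) →
            a ∈ t ∷ a′ ∷ b′ ∷ [] → ¬ (b ∈ t ∷ a′ ∷ b′ ∷ [])
    apart a≢b d a∈ b∈ = a≢b (trans (is-target d (here refl) a∈) (sym (is-target d at₂ b∈)))
    go : ∀ {T T′} → Token a b t T → Token a′ b′ t′ T′ → T ≢ T′
    go triple triple eq = apart (a≢b f) disjoint (⊆′ at₂) (⊆′ at₃)
      where
      ⊆′ : _ ⊆ _
      ⊆′ = ⊕-reflects-⊆ e₀ (unique-triple f) eq
    go triple (edge s∈′) eq = apart (a≢b f) disjoint (⊆′ at₂) (⊆′ at₃)
      where
      ⊆′ : _ ⊆ _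
      ⊆′ = rotate s∈′ ∘ ⊕-reflects-⊆ e₀ (unique-triple f) eq
    go (quad w∉ _) triple eq = apart (a≢b f) disjoint (⊆′ at₃) (⊆′ at₄)
      where
      ⊆′ : _ ⊆ _
      ⊆′ = ⊕-reflects-⊆ e₀ (unique-quad f w∉) eq
    go (quad w∉ _) (edge s∈′) eq = apart (a≢b f) disjoint (⊆′ at₃) (⊆′ at₄)
      where
      ⊆′ : _ ⊆ _
      ⊆′ = rotate s∈′ ∘ ⊕-reflects-⊆ e₀ (unique-quad f w∉) eq
    go (edge s∈) triple eq = apart (a≢b f′) disjoint′ (⊆′ at₂) (⊆′ at₃)
      where
      ⊆′ : _ ⊆ _
      ⊆′ = rotate s∈ ∘ ⊕-reflects-⊆ e₀ (unique-triple f′) (sym eq)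
    go (edge s∈) (quad w∉ _) eq = apart (a≢b f′) disjoint′ (⊆′ at₃) (⊆′ at₄)
      where
      ⊆′ : _ ⊆ _
      ⊆′ = rotate s∈ ∘ ⊕-reflects-⊆ e₀ (unique-quad f′ w∉) (sym eq)
    go triple (quad w∉ _) eq = apart (a≢b f′) disjoint′ (⊆′ at₃) (⊆′ at₄)
      where
      ⊆′ : _ ⊆ _
      ⊆′ = ⊕-reflects-⊆ e₀ (unique-quad f′ w∉) (sym eq)
    go (edge s∈) (edge s∈′) eq
      with ∈₂ (⊕-reflects-⊆ e₀ (unique-edge f s∈) eq (here refl))
         | ∈₂ (⊕-reflects-⊆ e₀ (unique-edge f s∈) eq at₂)
    ... | inj₁ refl | _         = disjoint s∈ s∈′
    ... | inj₂ refl | inj₁ refl = ¬mutual s∈′ s∈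
    ... | inj₂ refl | inj₂ refl = t∉ f s∈
    go (quad w∉ _) (quad w∉′ _) eq = ¬mutual
      (hits (a≢b f′) disjoint′ (⊇′ at₃) (⊇′ at₄))
      (hits (a≢b f) disjoint (⊆′ at₃) (⊆′ at₄))
      where
      ⊆′ : _ ⊆ _
      ⊆′ = ⊕-reflects-⊆ e₀ (unique-quad f w∉) eq
      ⊇′ : _ ⊆ _
      ⊇′ = ⊕-reflects-⊆ e₀ (unique-quad f′ w∉′) (sym eq)

  -- Matched pairs and the choice of targets.

  paired-matched : Head y → ∀ {s} → s ∈ y ∷ p y ∷ [] → p (p s) ≡ s
  paired-matched (_ , p²y≡y , _) s∈ with ∈₂ s∈
  ... | inj₁ refl = p²y≡y
  ... | inj₂ refl = cong p p²y≡y

  paired-moves : Head y → ∀ {s} → s ∈ y ∷ p y ∷ [] → p s ≢ s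
  paired-moves (py≢y , p²y≡y , _) s∈ with ∈₂ s∈
  ... | inj₁ refl = py≢y
  ... | inj₂ refl = λ p²y≡py → py≢y (trans (sym p²y≡py) p²y≡y)

  p-paired : Head y → ∀ {s} → s ∈ y ∷ p y ∷ [] → p s ∈ y ∷ p y ∷ []
  p-paired (_ , p²y≡y , _) s∈ with ∈₂ s∈
  ... | inj₁ refl = there (here refl)
  ... | inj₂ refl = here p²y≡y

  pairs-disjoint : Head y → Head y′ → y ≢ y′ → ∀ {s} → s ∈ y ∷ p y ∷ [] → s ∉ y′ ∷ p y′ ∷ []
  pairs-disjoint h@(_ , p²y≡y , _) h′@(_ , p²y′≡y′ , _) y≢y′ s∈ s∈′ with ∈₂ s∈ | ∈₂ s∈′
  ... | inj₁ refl | inj₁ refl   = y≢y′ refl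
  ... | inj₁ refl | inj₂ y≡py′  = ¬both-heads h′ h (sym y≡py′)
  ... | inj₂ refl | inj₁ py≡y′  = ¬both-heads h h′ py≡y′
  ... | inj₂ refl | inj₂ py≡py′ = y≢y′ (trans (sym p²y≡y) (trans (cong p py≡py′) p²y′≡y′))

  matched⇒head : ∀ {x} → p x ≢ x → p (p x) ≡ x → Head x ⊎ Head (p x)
  matched⇒head {x} px≢x p²x≡x with lookup e₀ x ≟ᵇ true
  ... | yes c = inj₁ (px≢x , p²x≡x , c)
  ... | no ¬c = inj₂ ((λ p²x≡px → px≢x (trans (sym p²x≡px) p²x≡x)) , p³≡p x ,
    trans (¬-not (≢-sym (balanced (≢-sym px≢x) (proj₂ (p-adjacent px≢x))))) (cong not (¬-not ¬c)))

  pair-fresh : Head y → t ∉ y ∷ p y ∷ [] → Fresh y (p y) t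
  pair-fresh (py≢y , _) t∉ = fresh (≢-sym py≢y) t∉

  pair-token-good : Head y → t ∉ y ∷ p y ∷ [] → p t ∉ y ∷ p y ∷ [] → Token y (p y) t T → Good T
  pair-token-good h t∉ pt∉ = token-good (pair-fresh h t∉)
    λ s∈ → (λ { refl → t∉ (p-paired h s∈) }) , (λ { refl → pt∉ s∈ })

  -- The first condition keeps the target out of the pair, which `p` preserves, and unattached to
  -- it, so the token is good. The second separates the tokens of different heads.
  byTargets : (t : Fin n → Fin n) →
              (∀ {y} → Head y → p (t y) ∉ y ∷ p y ∷ []) →
              (∀ {y y′} → Head y → Head y′ → t y ∈ y′ ∷ p y′ ∷ [] → t y′ ∉ y ∷ p y ∷ []) → Plenty
  byTargets t pt∉ ¬mutual = byTokens (proj₁ ∘ token) (proj₁ ∘ proj₂ ∘ token)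
    (λ h → pair-token-good h (t∉pair h) (pt∉ h) (proj₂ (proj₂ (token h)))) injective
    where
    token : ∀ {y} → Head y → ∃[ T ] Y T × Token y (p y) (t y) T
    token (py≢y , _) = move (p-adjacent py≢y) (t _)
    t∉pair : ∀ {y} → Head y → t y ∉ y ∷ p y ∷ []
    t∉pair h t∈ = pt∉ h (p-paired h t∈)
    injective : ∀ {y y′} (h : Head y) (h′ : Head y′) → proj₁ (token h) ≡ proj₁ (token h′) → y ≡ y′
    injective {y} {y′} h h′ eq with y ≟ y′
    ... | yes y≡y′ = y≡y′
    ... | no  y≢y′ = contradiction eq
      (tokens-distinct (pair-fresh h (t∉pair h)) (pair-fresh h′ (t∉pair h′)) (pairs-disjoint h h′ y≢y′)
        (¬mutual h h′) (proj₂ (proj₂ (token h))) (proj₂ (proj₂ (token h′))))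

  -- For graphs with two pairs, where one of the two sets may come from an exhaustive search instead
  -- of `move`.
  byTwoTokens : ∀ {h₁ h₂} → (∀ {y} → Head y → y ≡ h₁ ⊎ y ≡ h₂) →
                Y T → Good T → Y T′ → Good T′ → T ≢ T′ → Plenty
  byTwoTokens {T} {T′} {h₁} {h₂} heads T∈Y T-good T′∈Y T′-good T≢T′ =
    byTokens (λ {y} _ → tok y) (λ {y} _ → tok-Y y) (λ {y} _ → tok-good y) injective
    where
    tok : Fin n → Subset n
    tok y with y ≟ h₁
    ... | yes _ = T
    ... | no  _ = T′
    tok-Y : ∀ y → Y (tok y)
    tok-Y y with y ≟ h₁
    ... | yes _ = T∈Y
    ... | no  _ = T′∈Y
    tok-good : ∀ y → Good (tok y)
    tok-good y with y ≟ h₁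
    ... | yes _ = T-good
    ... | no  _ = T′-good
    injective : ∀ {y y′} → Head y → Head y′ → tok y ≡ tok y′ → y ≡ y′
    injective {y} {y′} h h′ eq with y ≟ h₁ | y′ ≟ h₁ | heads h | heads h′
    ... | yes y≡ | yes y′≡ | _       | _        = trans y≡ (sym y′≡)
    ... | yes _  | no  _   | _       | _        = contradiction eq T≢T′
    ... | no  _  | yes _   | _       | _        = contradiction (sym eq) T≢T′
    ... | no y≢  | no _    | inj₁ y≡ | _        = contradiction y≡ y≢
    ... | no _   | no y′≢  | inj₂ _  | inj₁ y′≡ = contradiction y′≡ y′≢
    ... | no _   | no _    | inj₂ y≡ | inj₂ y′≡ = trans y≡ (sym y′≡)

  -- Case analysis on the shape of the graph.

  Star : Set
  Star = Fin n × ∃[ c ] (∀ {x T} → OnlyAt c x T → C T)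

  -- With `e₀` consisting of `v₀` and `v₁`, the fields `e₁₂`, `e₂₃`, `e₃₀` name the other sides of
  -- the four-cycle by their end points. The four-vertex list has the order in which `move` produces
  -- a `quad`.
  record Square : Set where
    field
      {v₀ v₁ v₂ v₃} : Fin n
      distinct : Unique (v₀ ∷ v₁ ∷ v₂ ∷ v₃ ∷ [])
      cover    : ∀ x → x ∈ v₀ ∷ v₁ ∷ v₂ ∷ v₃ ∷ []
      colors   : lookup e₀ v₀ ≡ true × lookup e₀ v₁ ≡ true × lookup e₀ v₂ ≡ false × lookup e₀ v₃ ≡ false
      e₁₂      : C (e₀ ⊕ (v₀ ∷ v₂ ∷ []))
      e₃₀      : C (e₀ ⊕ (v₁ ∷ v₃ ∷ []))
      e₂₃      : C (e₀ ⊕ (v₃ ∷ v₁ ∷ v₀ ∷ v₂ ∷ []))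
      only     : ∀ {T} → C T → T ≡ e₀ ⊎ T ≡ e₀ ⊕ (v₀ ∷ v₂ ∷ []) ⊎ T ≡ e₀ ⊕ (v₁ ∷ v₃ ∷ [])
                   ⊎ T ≡ e₀ ⊕ (v₃ ∷ v₁ ∷ v₀ ∷ v₂ ∷ [])

  -- Matched vertices are moved by `p`, so the fixed vertex `x` lies in no pair and can be the
  -- target of every head.
  plenty-isolated : ∀ {x} → p x ≡ x → Plenty
  plenty-isolated {x} px≡x = byTargets (λ _ → x)
    (λ h px∈ → paired-moves h (subst (_∈ _) px≡x px∈) px≡x)
    (λ _ h′ x∈ _ → paired-moves h′ x∈ px≡x)

  -- The unmatched vertex `u` is the target of every pair except the one it is attached to, which
  -- takes another head. As `u` lies in no pair, mutual targets would have to be heads, and then two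
  -- pairs would contain `p u`.
  plenty-unmatched : ∀ {u} → p (p u) ≢ u → Head y → Head y′ → y ≢ y′ → Plenty
  plenty-unmatched {y} {y′} {u} p²u≢u h h′ y≢y′ = byTargets target pt∉ ¬mutual
    where
    other : Fin n → Fin n
    other s with s ≟ y
    ... | yes _ = y′
    ... | no  _ = y
    other-head : ∀ s → Head (other s)
    other-head s with s ≟ y
    ... | yes _ = h′
    ... | no  _ = h
    other≢ : ∀ s → s ≢ other s
    other≢ s with s ≟ y
    ... | yes refl = y≢y′
    ... | no  s≢y  = s≢y
    target : Fin n → Fin n
    target s with DecMembership._∈?_ _≟_ (p u) (s ∷ p s ∷ [])
    ... | yes _ = other s
    ... | no  _ = u
    other∉ : ∀ {s} → Head s → other s ∉ s ∷ p s ∷ []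
    other∉ {s} hs o∈ = pairs-disjoint hs (other-head s) (other≢ s) o∈ (here refl)
    pt∉ : ∀ {s} → Head s → p (target s) ∉ s ∷ p s ∷ []
    pt∉ {s} hs with DecMembership._∈?_ _≟_ (p u) (s ∷ p s ∷ [])
    ... | yes _  = λ po∈ → pairs-disjoint hs (other-head s) (other≢ s) po∈ at₂
    ... | no pu∉ = pu∉
    ¬mutual : ∀ {s s′} → Head s → Head s′ → target s ∈ s′ ∷ p s′ ∷ [] → target s′ ∉ s ∷ p s ∷ []
    ¬mutual {s} {s′} hs hs′ t∈ t′∈
      with DecMembership._∈?_ _≟_ (p u) (s ∷ p s ∷ []) | DecMembership._∈?_ _≟_ (p u) (s′ ∷ p s′ ∷ [])
    ... | no _    | _       = p²u≢u (paired-matched hs′ t∈)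
    ... | yes _   | no _    = p²u≢u (paired-matched hs t′∈)
    ... | yes pu∈ | yes pu∈′ with s ≟ s′
    ... | yes refl = other∉ hs t∈
    ... | no s≢s′  = pairs-disjoint hs hs′ s≢s′ pu∈ pu∈′

  -- `y` aims at `y′`, `y′` at `y″`, and every other head at `y`; two steps never lead back to the
  -- start.
  plenty-three-heads : ∀ {y″} → Head y → Head y′ → Head y″ → y ≢ y′ → y ≢ y″ → y′ ≢ y″ → Plenty
  plenty-three-heads {y} {y′} {y″} h h′ h″ y≢y′ y≢y″ y′≢y″ = byTargets target
    (λ {s} hs pt∈ → pairs-disjoint hs (t-head s) (t≢ s) pt∈ at₂) ¬mutual
    where
    target : Fin n → Fin n
    target s with s ≟ y | s ≟ y′
    ... | yes _ | _     = y′
    ... | no  _ | yes _ = y″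
    ... | no  _ | no  _ = y
    t-head : ∀ s → Head (target s)
    t-head s with s ≟ y | s ≟ y′
    ... | yes _ | _     = h′
    ... | no  _ | yes _ = h″
    ... | no  _ | no  _ = h
    t≢ : ∀ s → s ≢ target s
    t≢ s with s ≟ y | s ≟ y′
    ... | yes refl | _        = y≢y′
    ... | no  _    | yes refl = y′≢y″
    ... | no  s≢y  | no  _    = s≢y
    t²≢ : ∀ s → target (target s) ≢ s
    t²≢ s with s ≟ y | s ≟ y′
    t²≢ s | yes refl | _ with y′ ≟ s | y′ ≟ y′
    ... | yes y′≡y | _        = contradiction (sym y′≡y) y≢y′
    ... | no  _    | yes _    = ≢-sym y≢y″
    ... | no  _    | no y′≢y′ = contradiction refl y′≢y′
    t²≢ s | no _ | yes refl with y″ ≟ y | y″ ≟ s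
    ... | yes y″≡y | _         = contradiction (sym y″≡y) y≢y″
    ... | no _     | yes y″≡y′ = contradiction (sym y″≡y′) y′≢y″
    ... | no _     | no _      = y≢y′
    t²≢ s | no _ | no s≢y′ with y ≟ y
    ... | yes _  = ≢-sym s≢y′
    ... | no y≢y = contradiction refl y≢y
    t∈⇒≡ : ∀ {s s′} → Head s′ → target s ∈ s′ ∷ p s′ ∷ [] → target s ≡ s′
    t∈⇒≡ {s} {s′} hs′ t∈ with target s ≟ s′
    ... | yes eq = eq
    ... | no neq = contradiction t∈ (pairs-disjoint (t-head s) hs′ neq (here refl))
    ¬mutual : ∀ {s s′} → Head s → Head s′ → target s ∈ s′ ∷ p s′ ∷ [] → target s′ ∉ s ∷ p s ∷ []
    ¬mutual {s} hs hs′ t∈ t′∈ = t²≢ s (trans (cong target (t∈⇒≡ hs′ t∈)) (t∈⇒≡ hs t′∈))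

  -- By balance every other vertex has the colour opposite to `c`, so `e₀` is the singleton of `c`
  -- or its complement. Exchanging `c` with `x` moves the exceptional vertex to `x`.
  star : ∀ c → (∀ x → x ≢ c → c ~ x) → Star
  star c c~ = c , lookup e₀ c , star-C
    where
    color : ∀ x → x ≢ c → lookup e₀ x ≡ not (lookup e₀ c)
    color x x≢c = ¬-not (≢-sym (balanced (≢-sym x≢c) (proj₂ (c~ x x≢c))))
    star-C : ∀ {x T} → OnlyAt (lookup e₀ c) x T → C T
    star-C {x} {T} (at , away) with x ≟ c
    ... | yes refl = subst C (lookup-ext pointwise) e₀∈C
      where
      pointwise : ∀ w → lookup e₀ w ≡ lookup T w
      pointwise w with w ≟ x
      ... | yes refl = sym at
      ... | no w≢x   = trans (color w w≢x) (sym (away w w≢x))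
    ... | no x≢c = subst C (lookup-ext pointwise) (proj₂ (c~ x x≢c))
      where
      pointwise : ∀ w → lookup (e₀ ⊕ (c ∷ x ∷ [])) w ≡ lookup T w
      pointwise w with w ≟ x | w ≟ c
      ... | yes refl | _ = begin
        lookup (e₀ ⊕ (c ∷ w ∷ [])) w  ≡⟨ lookup-⊕-∈ e₀ (unique₂ (≢-sym x≢c)) at₂ ⟩
        not (lookup e₀ w)             ≡⟨ cong not (color w x≢c) ⟩
        not (not (lookup e₀ c))       ≡⟨ not-involutive _ ⟩
        lookup e₀ c                   ≡⟨ at ⟨
        lookup T w                    ∎
        where open ≡-Reasoning
      ... | no w≢x | yes refl = trans (lookup-⊕-∈ e₀ (unique₂ (≢-sym x≢c)) (here refl)) (sym (away w w≢x))
      ... | no w≢x | no w≢c   =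
        trans (lookup-⊕-∉ e₀ (λ w∈ → [ w≢c , w≢x ]′ (∈₂ w∈))) (trans (color w w≢c) (sym (away w w≢x)))

  -- The vertices `u`, `p y`, `y`, `v` form a path. Since `u` is attached to the matched pair, the
  -- token is built on the edge from `v` to `y` instead, with target `u`.
  plenty-path : ∀ {u v} → p y ≢ y → p (p y) ≡ y → p u ≡ p y → u ≢ y → p v ≡ y → v ≢ p y →
                (∀ {s} → Head s → s ≡ y) → Plenty
  plenty-path {y} {u} {v} py≢y p²y≡y pu≡py u≢y pv≡y v≢py unique =
    byTokens (λ _ → proj₁ moved) (λ _ → proj₁ (proj₂ moved))
      (λ _ → token-good (fresh v≢y u∉) unpaired (proj₂ (proj₂ moved)))
      λ h h′ _ → trans (unique h) (sym (unique h′))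
    where
    v≢y : v ≢ y
    v≢y refl = py≢y pv≡y
    moved = move (subst (v ~_) pv≡y (p-adjacent (λ pv≡v → v≢y (trans (sym pv≡v) pv≡y)))) u
    u∉ : u ∉ v ∷ y ∷ []
    u∉ u∈ with ∈₂ u∈
    ... | inj₁ refl = py≢y (trans (sym pu≡py) pv≡y)
    ... | inj₂ u≡y  = u≢y u≡y
    unpaired : ∀ {s} → s ∈ v ∷ y ∷ [] → p s ≢ u × p u ≢ s
    unpaired s∈ with ∈₂ s∈
    ... | inj₁ refl = (λ pv≡u → u≢y (trans (sym pv≡u) pv≡y)) , λ pu≡v → v≢py (trans (sym pu≡v) pu≡py)
    ... | inj₂ refl = (λ { refl → py≢y (trans (sym pu≡py) p²y≡y) }) , λ pu≡y → py≢y (trans (sym pu≡py) pu≡y)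

  -- `p x` is matched, so `p x` or its mate is a head, and `y` is the only one.
  points-into-pair : (∀ x → p x ≢ x) → (∀ {s} → Head s → s ≡ y) → ∀ x → p x ≡ y ⊎ p x ≡ p y
  points-into-pair moves unique x with matched⇒head (moves (p x)) (p³≡p x)
  ... | inj₁ h = inj₁ (unique h)
  ... | inj₂ h = inj₂ (trans (sym (p³≡p x)) (cong p (unique h)))

  -- Either both ends of the pair have a further vertex attached, which gives a path, or one end is
  -- adjacent to all other vertices.
  one-head : (∀ x → p x ≢ x) → Head y → (∀ {s} → Head s → s ≡ y) → Plenty ⊎ Star
  one-head {y} moves (py≢y , p²y≡y , _) unique
    with any? (λ u → (p u ≟ p y) ×-dec ¬? (u ≟ y)) | any? (λ v → (p v ≟ y) ×-dec ¬? (v ≟ p y))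
  ... | yes (u , pu≡py , u≢y) | yes (v , pv≡y , v≢py) =
    inj₁ (plenty-path py≢y p²y≡y pu≡py u≢y pv≡y v≢py unique)
  ... | no none | _ = inj₂ (star y λ x x≢y → toward x x≢y (points-into-pair moves unique x))
    where
    toward : ∀ x → x ≢ y → p x ≡ y ⊎ p x ≡ p y → y ~ x
    toward x _   (inj₁ px≡y)  = ~-sym (subst (x ~_) px≡y (p-adjacent (moves x)))
    toward x x≢y (inj₂ px≡py) = contradiction (x , px≡py , x≢y) none
  ... | yes _ | no none = inj₂ (star (p y) λ x x≢py → toward x x≢py (points-into-pair moves unique x))
    where
    toward : ∀ x → x ≢ p y → p x ≡ y ⊎ p x ≡ p y → p y ~ x
    toward x x≢py (inj₁ px≡y)  = contradiction (x , px≡y , x≢py) none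
    toward x _    (inj₂ px≡py) = ~-sym (subst (x ~_) px≡py (p-adjacent (moves x)))

  -- The pair of `y` is tried with `y′` and with its mate as target. The two tokens coincide only if
  -- all four vertices are flipped. Then any other good light set suffices, and without one the
  -- minimal edges are exactly those of a square.
  two-pairs : (∀ x → p x ≢ x) → (∀ x → p (p x) ≡ x) → Head y → Head y′ → y ≢ y′ →
              (∀ {s} → Head s → s ≡ y ⊎ s ≡ y′) → Plenty ⊎ Square
  two-pairs {y} {y′} moves matched h h′ y≢y′ heads = go (token y′) (token (p y′))
    where
    y′∈ : y′ ∈ y′ ∷ p y′ ∷ []
    y′∈ = here refl
    py′∈ : p y′ ∈ y′ ∷ p y′ ∷ []
    py′∈ = there (here refl)

    disjoint : ∀ {s} → s ∈ y ∷ p y ∷ [] → s ∉ y′ ∷ p y′ ∷ []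
    disjoint = pairs-disjoint h h′ y≢y′

    token : ∀ t → ∃[ T ] Y T × Token y (p y) t T
    token = move (p-adjacent (moves y))

    fr : t ∈ y′ ∷ p y′ ∷ [] → Fresh y (p y) t
    fr t∈ = pair-fresh h λ t∈′ → disjoint t∈′ t∈

    good : t ∈ y′ ∷ p y′ ∷ [] → Token y (p y) t T → Good T
    good t∈ = pair-token-good h (λ t∈′ → disjoint t∈′ t∈) (λ pt∈′ → disjoint pt∈′ (p-paired h′ t∈))

    cover : ∀ x → x ∈ y ∷ y′ ∷ p y ∷ p y′ ∷ []
    cover x with matched⇒head (moves x) (matched x)
    ... | inj₁ hx with heads hx
    ... | inj₁ x≡y  = here x≡y
    ... | inj₂ x≡y′ = there (here x≡y′)
    cover x | inj₂ hpx with heads hpx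
    ... | inj₁ px≡y  = there (there (here (trans (sym (matched x)) (cong p px≡y))))
    ... | inj₂ px≡y′ = there (there (there (here (trans (sym (matched x)) (cong p px≡y′)))))

    fourth : ∀ {w} → w ∉ y′ ∷ y ∷ p y ∷ [] → w ≡ p y′
    fourth {w} w∉ with cover w
    ... | here w≡y                          = contradiction (there (here w≡y)) w∉
    ... | there (here w≡y′)                 = contradiction (here w≡y′) w∉
    ... | there (there (here w≡py))         = contradiction (there (there (here w≡py))) w∉
    ... | there (there (there (here w≡py′))) = w≡py′

    full : Subset n
    full = e₀ ⊕ (p y′ ∷ y′ ∷ y ∷ p y ∷ [])

    square : Good full → C full → (∀ {T} → Y T → T ≡ full ⊎ ¬ Good T) → Square
    square full-good full∈C none = record
      { distinct = (y≢y′ ∷ ≢-sym (moves y) ∷ (λ y≡py′ → disjoint (here refl) (there (here y≡py′))) ∷ [])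
                 ∷ ((λ y′≡py → disjoint at₂ (here (sym y′≡py))) ∷ ≢-sym (moves y′) ∷ [])
                 ∷ unique₂ (λ py≡py′ → disjoint at₂ (there (here py≡py′)))
      ; cover    = cover
      ; colors   = color h , color h′ , mate-color h , mate-color h′
      ; e₁₂      = proj₂ (p-adjacent (moves y))
      ; e₃₀      = proj₂ (p-adjacent (moves y′))
      ; e₂₃      = full∈C
      ; only     = λ {T} T∈C → only T (none (C⊆Y T∈C))
      }
      where
      color : ∀ {s} → Head s → lookup e₀ s ≡ true
      color (_ , _ , c) = c
      mate-color : ∀ {s} → Head s → lookup e₀ (p s) ≡ false
      mate-color {s} (_ , _ , c) = trans
        (¬-not (≢-sym (balanced (≢-sym (moves s)) (proj₂ (p-adjacent (moves s)))))) (cong not c)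
      pair-duo : ∀ x → pair x ≡ x ∷ p x ∷ []
      pair-duo x with pairView x
      ... | _ , duo _       = refl
      ... | _ , solo px≡x = contradiction px≡x (moves x)
      swapped : ∀ s → e₀ ⊕ pair (p s) ≡ e₀ ⊕ (s ∷ p s ∷ [])
      swapped s = trans (cong (e₀ ⊕_) (pair-duo (p s)))
        (trans (cong (λ w → e₀ ⊕ (p s ∷ w ∷ [])) (matched s)) (flip-comm (p s) s e₀))
      as-pair : ∀ {x} T → T ≡ e₀ ⊕ pair x → x ∈ y ∷ y′ ∷ p y ∷ p y′ ∷ [] →
                T ≡ e₀ ⊕ (y ∷ p y ∷ []) ⊎ T ≡ e₀ ⊕ (y′ ∷ p y′ ∷ [])
      as-pair T eq (here refl)                          = inj₁ (trans eq (cong (e₀ ⊕_) (pair-duo y)))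
      as-pair T eq at₂                  = inj₂ (trans eq (cong (e₀ ⊕_) (pair-duo y′)))
      as-pair T eq at₃          = inj₁ (trans eq (swapped y))
      as-pair T eq at₄ = inj₂ (trans eq (swapped y′))
      only : ∀ T → T ≡ full ⊎ ¬ Good T →
             T ≡ e₀ ⊎ T ≡ e₀ ⊕ (y ∷ p y ∷ []) ⊎ T ≡ e₀ ⊕ (y′ ∷ p y′ ∷ []) ⊎ T ≡ full
      only T (inj₁ T≡full) = inj₂ (inj₂ (inj₂ T≡full))
      only T (inj₂ bad) with T ≟ˢ e₀ | any? (λ x → T ≟ˢ (e₀ ⊕ pair x))
      ... | yes T≡e₀ | _            = inj₁ T≡e₀
      ... | no T≢e₀  | no none      = contradiction (T≢e₀ , λ x eq → none (x , eq)) bad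
      ... | no _     | yes (x , eq) with as-pair T eq (cover x)
      ... | inj₁ eq′ = inj₂ (inj₁ eq′)
      ... | inj₂ eq′ = inj₂ (inj₂ (inj₁ eq′))

    distinct-tokens : Y T → Token y (p y) y′ T → ∀ {xs} → T ≡ e₀ ⊕ xs → p y′ ∉ xs →
                      ∃[ T′ ] Y T′ × Token y (p y) (p y′) T′ → Plenty
    distinct-tokens T∈Y τ T≡ py′∉ (_ , T′∈Y , τ′) =
      byTwoTokens heads T∈Y (good y′∈ τ) T′∈Y (good py′∈ τ′)
        λ T≡T′ → py′∉ (target∈ (fr py′∈) τ′ (trans (sym T≡T′) T≡))

    go : ∃[ T ] Y T × Token y (p y) y′ T → ∃[ T ] Y T × Token y (p y) (p y′) T → Plenty ⊎ Square
    go (_ , T∈Y , triple) = inj₁ ∘ distinct-tokens T∈Y triple refl λ where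
      (here py′≡y′) → moves y′ py′≡y′
      (there py′∈′) → disjoint py′∈′ py′∈
    go (_ , T∈Y , edge s∈) = inj₁ ∘ distinct-tokens T∈Y (edge s∈) refl λ where
      (here refl)   → disjoint s∈ py′∈
      (there py′∈′) → moves y′ (∈₁ py′∈′)
    -- With only four vertices this token is `full`. The second token may be the same set, hence the
    -- search for another good one.
    go (_ , T∈Y , quad w∉ T∈C) _ with fourth w∉
    ... | refl with ∃-subset? (λ T → Y? T ×-dec good? T ×-dec ¬? (T ≟ˢ full))
    ... | yes (T , T∈Y′ , T-good , T≢full) =
      inj₁ (byTwoTokens heads T∈Y′ T-good T∈Y (good y′∈ (quad w∉ T∈C)) T≢full)
    ... | no none = inj₂ (square (good y′∈ (quad w∉ T∈C)) T∈C λ {T} T∈Y → classify T T∈Y)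
      where
      classify : ∀ T → Y T → T ≡ full ⊎ ¬ Good T
      classify T T∈Y with T ≟ˢ full
      ... | yes T≡full = inj₁ T≡full
      ... | no  T≢full = inj₂ λ T-good → none (T , T∈Y , T-good , T≢full)

  trichotomy : Plenty ⊎ Star ⊎ Square
  trichotomy with any? head?
  -- Without heads no token is required, and `id` is a vacuous choice of targets.
  ... | no none = inj₁ (byTargets id (λ h → contradiction (_ , h) none) (λ h → contradiction (_ , h) none))
  ... | yes (y , h) with any? (λ x → p x ≟ x)
  ... | yes (x , px≡x) = inj₁ (plenty-isolated px≡x)
  ... | no none with any? (λ y′ → head? y′ ×-dec ¬? (y ≟ y′))
  ... | no ¬h′ = [ inj₁ , inj₂ ∘ inj₁ ]′ (one-head (λ x px≡x → none (x , px≡x)) h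
    λ {s} hs → decidable-stable (s ≟ y) λ s≢y → ¬h′ (s , hs , ≢-sym s≢y))
  ... | yes (y′ , h′ , y≢y′) with any? (λ u → ¬? (p (p u) ≟ u))
  ... | yes (u , p²u≢u) = inj₁ (plenty-unmatched p²u≢u h h′ y≢y′)
  ... | no ¬u with any? (λ y″ → head? y″ ×-dec ¬? (y ≟ y″) ×-dec ¬? (y′ ≟ y″))
  ... | yes (y″ , h″ , y≢y″ , y′≢y″) = inj₁ (plenty-three-heads h h′ h″ y≢y′ y≢y″ y′≢y″)
  ... | no ¬h″ = [ inj₁ , inj₂ ∘ inj₂ ]′ (two-pairs (λ x px≡x → none (x , px≡x))
    (λ x → decidable-stable (p (p x) ≟ x) λ ne → ¬u (x , ne)) h h′ y≢y′ heads)
    where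
    heads : ∀ {s} → Head s → s ≡ y ⊎ s ≡ y′
    heads {s} hs with s ≟ y | s ≟ y′
    ... | yes s≡y | _        = inj₁ s≡y
    ... | no _    | yes s≡y′ = inj₂ s≡y′
    ... | no s≢y  | no s≢y′  = contradiction (s , hs , ≢-sym s≢y , ≢-sym s≢y′) ¬h″

-- Sizes of subsets

-- Both sides count the union of `S` and `T`.
∣∣-exchange : (S T : Subset n) → ∣ S ∣ + ∣ ∁ S ∩ T ∣ ≡ ∣ T ∣ + ∣ ∁ T ∩ S ∣
∣∣-exchange []            []            = refl
∣∣-exchange (outside ∷ S) (outside ∷ T) = ∣∣-exchange S T
∣∣-exchange (inside  ∷ S) (inside  ∷ T) = cong ℕ.suc (∣∣-exchange S T)
∣∣-exchange (outside ∷ S) (inside  ∷ T) = trans (+-suc ∣ S ∣ _) (cong ℕ.suc (∣∣-exchange S T))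
∣∣-exchange (inside  ∷ S) (outside ∷ T) = trans (cong ℕ.suc (∣∣-exchange S T)) (sym (+-suc ∣ T ∣ _))

difference-0 : (S T : Subset n) → ∣ ∁ T ∩ S ∣ + ∣ ∁ S ∩ T ∣ ≡ 0 → S ≡ T
difference-0 []            []            _  = refl
difference-0 (outside ∷ S) (outside ∷ T) eq = cong (outside ∷_) (difference-0 S T eq)
difference-0 (inside  ∷ S) (inside  ∷ T) eq = cong (inside ∷_) (difference-0 S T eq)
difference-0 (outside ∷ S) (inside  ∷ T) eq with trans (sym (+-suc ∣ ∁ T ∩ S ∣ _)) eq
... | ()

difference-1 : (S T : Subset n) → ∣ ∁ T ∩ S ∣ + ∣ ∁ S ∩ T ∣ ≡ 1 → ∃[ w ] S ≡ flip w T
difference-1 []            []            ()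
difference-1 (outside ∷ S) (outside ∷ T) eq =
  let w , S≡ = difference-1 S T eq in suc w , cong (outside ∷_) S≡
difference-1 (inside  ∷ S) (inside  ∷ T) eq =
  let w , S≡ = difference-1 S T eq in suc w , cong (inside ∷_) S≡
difference-1 (outside ∷ S) (inside  ∷ T) eq =
  zero , cong (outside ∷_) (difference-0 S T (ℕₚ.suc-injective (trans (sym (+-suc ∣ ∁ T ∩ S ∣ _)) eq)))
difference-1 (inside  ∷ S) (outside ∷ T) eq =
  zero , cong (inside ∷_) (difference-0 S T (ℕₚ.suc-injective eq))

∣∁S∩S∣≡0 : (S : Subset n) → ∣ ∁ S ∩ S ∣ ≡ 0
∣∁S∩S∣≡0 []            = refl
∣∁S∩S∣≡0 (outside ∷ S) = ∣∁S∩S∣≡0 S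
∣∁S∩S∣≡0 (inside  ∷ S) = ∣∁S∩S∣≡0 S

flip-∉ : ∀ (x : Fin n) S → lookup S x ≡ false → ∣ flip x S ∣ ≡ ℕ.suc ∣ S ∣ × ∣ ∁ (flip x S) ∩ S ∣ ≡ 0
flip-∉ zero    (outside ∷ S) _ = refl , ∣∁S∩S∣≡0 S
flip-∉ (suc x) (outside ∷ S) x∉ = flip-∉ x S x∉
flip-∉ (suc x) (inside  ∷ S) x∉ = let p , q = flip-∉ x S x∉ in cong ℕ.suc p , q

flip-∈ : ∀ (x : Fin n) S → lookup S x ≡ true → ℕ.suc ∣ flip x S ∣ ≡ ∣ S ∣ × ∣ ∁ (flip x S) ∩ S ∣ ≡ 1
flip-∈ zero    (inside  ∷ S) _ = refl , cong ℕ.suc (∣∁S∩S∣≡0 S)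
flip-∈ (suc x) (outside ∷ S) x∈ = flip-∈ x S x∈
flip-∈ (suc x) (inside  ∷ S) x∈ = let p , q = flip-∈ x S x∈ in cong ℕ.suc p , q

-- In the use below s = ∣ f ∣, a = ∣ ∁ T ∩ f ∣ and b = ∣ ∁ f ∩ T ∣ for T = flip x e, with
-- ∣ e ∣ = k in the first lemma and ∣ e ∣ = suc t in the second.
private
  arith-∉ : ∀ {k s a b} → k ≤ s → s + a ≤ k + 0 → s + b ≡ ℕ.suc k + a → s ≡ k × a + b ≡ 1
  arith-∉ {k} {s} {a} {b} k≤s s+a≤k eq
    with ≤-antisym (≤-trans (m≤m+n s a) (≤-trans s+a≤k (≤-reflexive (+-identityʳ k)))) k≤s
  ... | refl with n≤0⇒n≡0 (+-cancelˡ-≤ s a 0 s+a≤k)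
  ... | refl = refl , +-cancelˡ-≡ s b 1 (trans eq (trans (cong ℕ.suc (+-identityʳ s)) (+-comm 1 s)))

  arith-∈ : ∀ {t s a b} → ℕ.suc t ≤ s → s + a ≤ ℕ.suc t + 1 → s + b ≡ t + a → s ≡ ℕ.suc t × a + b ≡ 1
  arith-∈ {t} {s} {ℕ.zero} {b} t<s _ eq =
    contradiction (≤-trans (m≤m+n s b) (≤-reflexive (trans eq (+-identityʳ t)))) (<⇒≱ t<s)
  arith-∈ {t} {s} {ℕ.suc a} {b} t<s s+a≤ eq with s+a≤t+1
    where
    s+a≤t+1 : s + a ≤ ℕ.suc t
    s+a≤t+1 = +-cancelˡ-≤ 1 _ _ (subst₂ _≤_ (+-suc s a) (+-comm (ℕ.suc t) 1) s+a≤)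
  ... | le with ≤-antisym (≤-trans (m≤m+n s a) le) t<s
  ... | refl with n≤0⇒n≡0 (+-cancelˡ-≤ s a 0 (subst (s + a ≤_) (sym (+-identityʳ s)) le))
  ... | refl = refl , cong ℕ.suc (+-cancelˡ-≡ s b 0 (trans eq (trans (+-comm t 1) (sym (+-identityʳ s)))))

-- As `f` is no smaller than `e`, being at most as heavy forces equal sizes and a symmetric
-- difference of `f` and `flip x e` with a single vertex `w`. For `w = x` the two flips would cancel
-- and give `f = e`.
blocker : ∀ {e f : Subset n} x → ∣ e ∣ ≤ ∣ f ∣ → f ≢ e →
          ∣ f ∣ + ∣ ∁ (flip x e) ∩ f ∣ ≤ ∣ e ∣ + ∣ ∁ (flip x e) ∩ e ∣ →
          ∣ f ∣ ≡ ∣ e ∣ × (∃[ w ] w ≢ x × f ≡ flip w (flip x e))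
blocker {e = e} {f} x e≤f f≢e le = proj₁ sizes , w , w≢x , f≡
  where
  T = flip x e
  sizes : ∣ f ∣ ≡ ∣ e ∣ × ∣ ∁ T ∩ f ∣ + ∣ ∁ f ∩ T ∣ ≡ 1
  sizes with lookup e x in x∈?
  ... | false = let p , q = flip-∉ x e x∈? in
    arith-∉ e≤f (subst (λ c → ∣ f ∣ + ∣ ∁ T ∩ f ∣ ≤ ∣ e ∣ + c) q le)
      (subst (λ c → ∣ f ∣ + ∣ ∁ f ∩ T ∣ ≡ c + ∣ ∁ T ∩ f ∣) p (∣∣-exchange f T))
  ... | true = let p , q = flip-∈ x e x∈?
                   r , s = arith-∈ (subst (_≤ ∣ f ∣) (sym p) e≤f)
                     (subst₂ (λ k c → ∣ f ∣ + ∣ ∁ T ∩ f ∣ ≤ k + c) (sym p) q le) (∣∣-exchange f T)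
               in trans r p , s
  w = proj₁ (difference-1 f T (proj₂ sizes))
  f≡ = proj₂ (difference-1 f T (proj₂ sizes))
  w≢x : w ≢ x
  w≢x w≡x = f≢e (trans f≡ (trans (cong (λ v → flip v T) w≡x) (flip-involutive x e)))

-- Flipping two vertices of the same colour changes the size by two.
same-size⇒balanced : ∀ {e : Subset n} {x y} → x ≢ y → ∣ e ⊕ (x ∷ y ∷ []) ∣ ≡ ∣ e ∣ → lookup e x ≢ lookup e y
same-size⇒balanced {e = e} {x} {y} x≢y eq same with lookup e x in x∈? | lookup e y in y∈?
... | false | false = m+1+n≢m ∣ e ∣ {1} (trans (+-comm ∣ e ∣ 2) (trans (sym
        (trans (proj₁ (flip-∉ x (flip y e) (trans (lookup-⊕-∉ e x∉) x∈?)))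
               (cong ℕ.suc (proj₁ (flip-∉ y e y∈?))))) eq))
  where
  x∉ : x ∉ y ∷ []
  x∉ = x≢y ∘ ∈₁
... | true | true = m+1+n≢m ∣ e ⊕ (x ∷ y ∷ []) ∣ {1} (trans (+-comm _ 2) (trans
        (trans (cong ℕ.suc (proj₁ (flip-∈ x (flip y e) (trans (lookup-⊕-∉ e x∉) x∈?))))
               (proj₁ (flip-∈ y e y∈?))) (sym eq)))
  where
  x∉ : x ∉ y ∷ []
  x∉ = x≢y ∘ ∈₁

-- Versals for edges of minimal size

module MinimalEdges (H : Hypergraph n m) {k : ℕ} (minimal : ∀ {f} → f ∈ᵛ edges H → k ≤ ∣ f ∣) where

  C : Pred (Subset n) 0ℓ
  C T = T ∈ᵛ edges H × ∣ T ∣ ≡ k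

  C? : Decidable C
  C? T = VecAny.any? (T ≟ˢ_) (edges H) ×-dec (∣ T ∣ ℕ.≟ k)

  -- Against `∁ T` the edge `T` weighs only its size, the least possible. An edge `f` that is no
  -- heavier has that size too and no vertex outside `T`.
  complement-versal : ∀ {T} → C T → Z H (∁ T)
  complement-versal {T} (T∈H , refl) = T , T∈H , λ {f} f∈H f≢T → ≰⇒> λ le → f≢T (equal f (minimal f∈H) le)
    where
    equal : ∀ f → ∣ T ∣ ≤ ∣ f ∣ → ∣ f ∣ + ∣ ∁ T ∩ f ∣ ≤ ∣ T ∣ + ∣ ∁ T ∩ T ∣ → f ≡ T
    equal f T≤f le = difference-0 f T (cong₂ _+_ a≡0 b≡0)
      where
      le′ : ∣ f ∣ + ∣ ∁ T ∩ f ∣ ≤ ∣ T ∣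
      le′ = subst (∣ f ∣ + ∣ ∁ T ∩ f ∣ ≤_) (trans (cong (∣ T ∣ +_) (∣∁S∩S∣≡0 T)) (+-identityʳ _)) le
      a≡0 : ∣ ∁ T ∩ f ∣ ≡ 0
      a≡0 = n≤0⇒n≡0 (+-cancelˡ-≤ ∣ f ∣ _ 0 (≤-trans le′ (≤-trans T≤f (≤-reflexive (sym (+-identityʳ _))))))
      f≡T : ∣ f ∣ ≡ ∣ T ∣
      f≡T = ≤-antisym (≤-trans (m≤m+n _ _) le′) T≤f
      b≡0 : ∣ ∁ f ∩ T ∣ ≡ 0
      b≡0 = +-cancelˡ-≡ ∣ f ∣ _ _ (trans (∣∣-exchange f T) (cong₂ _+_ (sym f≡T) a≡0))

  -- The set is tested as a versal for `T` itself; an edge at most as heavy as `T` falls under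
  -- `blocker`, which yields the exchange.
  versal-or-exchange : ∀ {T} → C T → ∀ x → Z H (∁ (flip x T)) ⊎ (∃[ w ] w ≢ x × C (flip w (flip x T)))
  versal-or-exchange {T} (T∈H , refl) x
    with VecAny.any? (λ f → ¬? (f ≟ˢ T) ×-dec (weight f ≤? weight T)) (edges H)
    where
    weight : Subset n → ℕ
    weight f = ∣ f ∣ + ∣ ∁ (flip x T) ∩ f ∣
  ... | no none = inj₁ (T , T∈H , λ f∈H f≢T → ≰⇒> λ le → none (toAny f∈H (f≢T , le)))
  ... | yes some =
    let f , f∈H , f≢T , le = fromAny some
        f≡T , w , w≢x , f≡ = blocker x (minimal f∈H) f≢T le
    in inj₂ (w , w≢x , subst (_∈ᵛ edges H) f≡ f∈H , trans (cong ∣_∣ (sym f≡)) f≡T)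

minimal-edge : (es : Vec (Subset n) m) → 1 ≤ m → ∃[ e ] e ∈ᵛ es × (∀ {f} → f ∈ᵛ es → ∣ e ∣ ≤ ∣ f ∣)
minimal-edge (e ∷ []) _ = e , here refl , λ { (here refl) → ≤-refl }
minimal-edge (e ∷ es@(_ ∷ _)) _ with minimal-edge es (s≤s z≤n)
... | e′ , e′∈es , least with ≤-total ∣ e ∣ ∣ e′ ∣
... | inj₁ e≤e′ = e , here refl , λ { (here refl) → ≤-refl ; (there f∈) → ≤-trans e≤e′ (least f∈) }
... | inj₂ e′≤e = e′ , there e′∈es , λ { (here refl) → e′≤e ; (there f∈) → least f∈ }

-- Counting versals

lookup-injective : ∀ {A : Set} {xs : List A} → Unique xs →
                   ∀ i j → List.lookup xs i ≡ List.lookup xs j → i ≡ j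
lookup-injective (_ ∷ _)  zero    zero    _  = refl
lookup-injective (x# ∷ _) zero    (suc j) eq = contradiction eq (All.lookup x# (Membershipₚ.∈-lookup j))
lookup-injective (x# ∷ _) (suc i) zero    eq = contradiction (sym eq) (All.lookup x# (Membershipₚ.∈-lookup i))
lookup-injective (_ ∷ u)  (suc i) (suc j) eq = cong suc (lookup-injective u i j eq)

module _ (H : Hypergraph n m) where

  versals : List (Subset n)
  versals = filter (Z? H) (allSubsets n)

  ∈-versals⁺ : ∀ {S} → Z H S → S ∈ versals
  ∈-versals⁺ S∈Z = Membershipₚ.∈-filter⁺ (Z? H) (∈-allSubsets _) S∈Z

  versal : Fin ∣Z H ∣ → Subset n
  versal = List.lookup versals

  versal-Z : ∀ i → Z H (versal i)
  versal-Z i = proj₂ (Membershipₚ.∈-filter⁻ (Z? H) {xs = allSubsets n} (Membershipₚ.∈-lookup i))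

  versal-injective : Injective _≡_ _≡_ versal
  versal-injective = lookup-injective (Uniqueₚ.filter⁺ (Z? H) (allSubsets-unique n)) _ _

  ∣Z∣-lower : ∀ {k} (S : Fin k → Subset n) → Injective _≡_ _≡_ S → (∀ i → Z H (S i)) → k ≤ ∣Z H ∣
  ∣Z∣-lower S S-injective S∈Z = injective⇒≤ {f = λ i → Any.index (∈-versals⁺ (S∈Z i))}
    λ eq → S-injective (SetoidMemₚ.index-injective (setoid _) (∈-versals⁺ (S∈Z _)) (∈-versals⁺ (S∈Z _)) eq)

  ∣Z∣-upper : ∀ {k} (S : Fin k → Subset n) → (∀ {T} → Z H T → ∃[ i ] T ≡ S i) → ∣Z H ∣ ≤ k
  ∣Z∣-upper S S-covers = injective⇒≤ {f = λ i → proj₁ (S-covers (versal-Z i))} λ {i} {j} eq →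
    versal-injective (trans (proj₂ (S-covers (versal-Z i)))
      (trans (cong S eq) (sym (proj₂ (S-covers (versal-Z j))))))

-- Isomorphisms

lookup-image : ∀ (π : Permutation n n′) S x → lookup (image π S) x ≡ lookup S (π ⟨$⟩ˡ x)
lookup-image π S = lookup∘tabulate _

image-inverseʳ : ∀ (π : Permutation n n′) S → image π (image (Perm.flip π) S) ≡ S
image-inverseʳ π S = lookup-ext λ x → trans (lookup-image π (image (Perm.flip π) S) x)
  (trans (lookup-image (Perm.flip π) S _) (cong (lookup S) (inverseʳ π)))

image-inverseˡ : ∀ (π : Permutation n n′) S → image (Perm.flip π) (image π S) ≡ S
image-inverseˡ π = image-inverseʳ (Perm.flip π)

image-injective : ∀ (π : Permutation n n′) {S T} → image π S ≡ image π T → S ≡ T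
image-injective π {S} {T} eq =
  trans (sym (image-inverseˡ π S)) (trans (cong (image (Perm.flip π)) eq) (image-inverseˡ π T))

image-∩ : ∀ (π : Permutation n n′) S T → image π (S ∩ T) ≡ image π S ∩ image π T
image-∩ π S T = lookup-ext λ x → begin
  lookup (image π (S ∩ T)) x                        ≡⟨ lookup-image π (S ∩ T) x ⟩
  lookup (S ∩ T) (π ⟨$⟩ˡ x)                         ≡⟨ lookup-zipWith _∧_ (π ⟨$⟩ˡ x) S T ⟩
  lookup S (π ⟨$⟩ˡ x) ∧ lookup T (π ⟨$⟩ˡ x)         ≡⟨ cong₂ _∧_ (lookup-image π S x) (lookup-image π T x) ⟨
  lookup (image π S) x ∧ lookup (image π T) x       ≡⟨ lookup-zipWith _∧_ x (image π S) (image π T) ⟨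
  lookup (image π S ∩ image π T) x                  ∎
  where open ≡-Reasoning

indicator : Bool → ℕ
indicator b = if b then 1 else 0

-- In this form the size is visibly invariant under reindexing by a permutation.
∣∣-sum : (S : Subset n) → ∣ S ∣ ≡ sum +-0-commutativeMonoid (indicator ∘ lookup S)
∣∣-sum []            = refl
∣∣-sum (outside ∷ S) = ∣∣-sum S
∣∣-sum (inside  ∷ S) = cong ℕ.suc (∣∣-sum S)

∣image∣ : ∀ (π : Permutation n n′) S → ∣ image π S ∣ ≡ ∣ S ∣
∣image∣ π S = begin
  ∣ image π S ∣                              ≡⟨ ∣∣-sum (image π S) ⟩
  Σ (indicator ∘ lookup (image π S))         ≡⟨ sum-cong-≗ +-0-commutativeMonoid (cong indicator ∘ lookup-image π S) ⟩
  Σ (indicator ∘ lookup S ∘ (π ⟨$⟩ˡ_))       ≡⟨ sum-permute +-0-commutativeMonoid (indicator ∘ lookup S) (Perm.flip π) ⟨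
  Σ (indicator ∘ lookup S)                   ≡⟨ ∣∣-sum S ⟨
  ∣ S ∣                                      ∎
  where
  open ≡-Reasoning
  Σ : ∀ {k} → (Fin k → ℕ) → ℕ
  Σ = sum +-0-commutativeMonoid

≅-sym : {H : Hypergraph n m} {G : Hypergraph n′ m′} → H ≅ G → G ≅ H
≅-sym {H = H} {G} (π , iso) = Perm.flip π , λ e → mk⇔
  (λ e∈G → Equivalence.from (iso _) (subst (_∈ᵛ edges G) (sym (image-inverseʳ π e)) e∈G))
  (λ e∈H → subst (_∈ᵛ edges G) (image-inverseʳ π e) (Equivalence.to (iso _) e∈H))

-- `image π` preserves intersections and sizes, hence weights, and every edge of `G` is the image of
-- an edge of `H`.
Z-image : {H : Hypergraph n m} {G : Hypergraph n′ m′} ((π , _) : H ≅ G) → ∀ S → Z H S → Z G (image π S)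
Z-image {H = H} {G} (π , iso) S (e , e∈H , e-versal) =
  image π e , Equivalence.to (iso e) e∈H , λ {f} f∈G f≢ →
    let f′   = image (Perm.flip π) f
        f≡   = image-inverseʳ π f
        f′∈H = Equivalence.from (iso f′) (subst (_∈ᵛ edges G) (sym f≡) f∈G)
    in subst₂ _<_ (sym (weight e))
         (trans (sym (weight f′)) (cong (λ g → ∣ g ∣ + ∣ image π S ∩ g ∣) f≡))
         (e-versal f′∈H λ f′≡e → f≢ (trans (sym f≡) (cong (image π) f′≡e)))
  where
  weight : ∀ g → ∣ image π g ∣ + ∣ image π S ∩ image π g ∣ ≡ ∣ g ∣ + ∣ S ∩ g ∣
  weight g = cong₂ _+_ (∣image∣ π g) (trans (cong ∣_∣ (sym (image-∩ π S g))) (∣image∣ π (S ∩ g)))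

∣Z∣-mono : {H : Hypergraph n m} {G : Hypergraph n′ m′} → H ≅ G → ∣Z H ∣ ≤ ∣Z G ∣
∣Z∣-mono {H = H} {G} H≅G@(π , _) = ∣Z∣-lower G (image π ∘ versal H)
  (λ eq → versal-injective H (image-injective π eq))
  (λ i → Z-image {H = H} {G} H≅G (versal H i) (versal-Z H i))

∣Z∣-cong : {H : Hypergraph n m} {G : Hypergraph n′ m′} → H ≅ G → ∣Z H ∣ ≡ ∣Z G ∣
∣Z∣-cong {H = H} {G} H≅G = ≤-antisym (∣Z∣-mono {H = H} {G} H≅G) (∣Z∣-mono {H = G} {H} (≅-sym {H = H} {G} H≅G))

-- The exceptional hypergraphs

onlyAt-⁅⁆ : (x : Fin n) → OnlyAt true x ⁅ x ⁆
onlyAt-⁅⁆ x = []=⇒lookup (x∈⁅x⁆ x) , λ w w≢x → ¬-not λ w∈ → w≢x (x∈⁅y⁆⇒x≡y x (lookup⇒[]= w _ w∈))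

onlyAt-∁⁅⁆ : (x : Fin n) → OnlyAt false x (∁ ⁅ x ⁆)
onlyAt-∁⁅⁆ x with onlyAt-⁅⁆ x
... | at , away = trans (lookup-map x not ⁅ x ⁆) (cong not at) ,
  λ w w≢x → trans (lookup-map w not ⁅ x ⁆) (cong not (away w w≢x))

onlyAt-unique : ∀ {c} {x : Fin n} {S T} → OnlyAt c x S → OnlyAt c x T → S ≡ T
onlyAt-unique {x = x} {S} {T} (atS , awayS) (atT , awayT) = lookup-ext pointwise
  where
  pointwise : ∀ w → lookup S w ≡ lookup T w
  pointwise w with w ≟ x
  ... | yes refl = trans atS (sym atT)
  ... | no  w≢x  = trans (awayS w w≢x) (sym (awayT w w≢x))

onlyAt-injective : ∀ {c} {x y : Fin n} S → OnlyAt c x S → OnlyAt c y S → x ≡ y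
onlyAt-injective {x = x} {y} _ (at , away) (at′ , _) with x ≟ y
... | yes x≡y = x≡y
... | no  x≢y = contradiction (trans (sym at′) (away y (≢-sym x≢y))) (not-¬ refl)

another : n ≢ 1 → (x : Fin n) → ∃[ y ] y ≢ x
another {ℕ.suc ℕ.zero}    n≢1 _ = contradiction refl n≢1
another {ℕ.suc (ℕ.suc n)} _   x = punchIn x zero , punchInᵢ≢i x zero

weight : Subset n → Subset n → ℕ
weight S e = ∣ e ∣ + ∣ S ∩ e ∣

-- By `compare`, a set is versal for `e x` exactly when `x` alone has colour `c` in it, so the
-- versals are the sets `s x`. This covers singletons and their complements at once.
∣Z∣-onlyAt : (H : Hypergraph n m) → n ≢ 1 → ∀ c (e s : Fin n → Subset n) → (∀ x → OnlyAt c x (s x)) →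
             (∀ x → e x ∈ᵛ edges H) → (∀ {f} → f ∈ᵛ edges H → ∃[ x ] f ≡ e x) → Injective _≡_ _≡_ e →
             (∀ S x y → weight S (e x) < weight S (e y) ⇔ (lookup S x ≡ c × lookup S y ≡ not c)) →
             ∣Z H ∣ ≡ n
∣Z∣-onlyAt H n≢1 c e s only e∈H H⊆e e-injective compare =
  ≤-antisym (∣Z∣-upper H s upper) (∣Z∣-lower H s s-injective lower)
  where
  s-injective : Injective _≡_ _≡_ s
  s-injective {x} {y} eq = onlyAt-injective (s x) (only x) (subst (OnlyAt c y) (sym eq) (only y))
  lower : ∀ x → Z H (s x)
  lower x = e x , e∈H x , λ f∈H f≢ex → lighter f≢ex (H⊆e f∈H)
    where
    lighter : ∀ {f} → f ≢ e x → ∃[ y ] f ≡ e y → weight (s x) (e x) < weight (s x) f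
    lighter f≢ex (y , refl) = Equivalence.from (compare (s x) x y)
      (proj₁ (only x) , proj₂ (only x) y λ y≡x → f≢ex (cong e y≡x))
  upper : ∀ {T} → Z H T → ∃[ x ] T ≡ s x
  upper {T} (f , f∈H , versal-f) with H⊆e f∈H
  -- The colour of `x` is read off from a comparison with a second vertex, which exists because
  -- `n ≢ 1`.
  ... | x , refl = x , onlyAt-unique (proj₁ (bits (proj₂ (another n≢1 x))) , λ _ → proj₂ ∘ bits) (only x)
    where
    bits : ∀ {y} → y ≢ x → lookup T x ≡ c × lookup T y ≡ not c
    bits y≢x = Equivalence.to (compare T x _) (versal-f (e∈H _) λ eq → y≢x (e-injective eq))

∣∩⁅⁆∣ : ∀ (S : Subset n) x → ∣ S ∩ ⁅ x ⁆ ∣ ≡ indicator (lookup S x)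
∣∩⁅⁆∣ {ℕ.suc n} (outside ∷ S) zero    = trans (cong ∣_∣ (∩-zeroʳ S)) (∣⊥∣≡0 n)
∣∩⁅⁆∣ {ℕ.suc n} (inside  ∷ S) zero    = cong ℕ.suc (trans (cong ∣_∣ (∩-zeroʳ S)) (∣⊥∣≡0 n))
∣∩⁅⁆∣ (outside ∷ S) (suc x) = ∣∩⁅⁆∣ S x
∣∩⁅⁆∣ (inside  ∷ S) (suc x) = ∣∩⁅⁆∣ S x

∣∩∁∣+∣∩∣ : (S T : Subset n) → ∣ S ∩ ∁ T ∣ + ∣ S ∩ T ∣ ≡ ∣ S ∣
∣∩∁∣+∣∩∣ []            []            = refl
∣∩∁∣+∣∩∣ (outside ∷ S) (_       ∷ T) = ∣∩∁∣+∣∩∣ S T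
∣∩∁∣+∣∩∣ (inside  ∷ S) (outside ∷ T) = cong ℕ.suc (∣∩∁∣+∣∩∣ S T)
∣∩∁∣+∣∩∣ (inside  ∷ S) (inside  ∷ T) = trans (+-suc ∣ S ∩ ∁ T ∣ _) (cong ℕ.suc (∣∩∁∣+∣∩∣ S T))

⁅⁆-injective : {x y : Fin n} → ⁅ x ⁆ ≡ ⁅ y ⁆ → x ≡ y
⁅⁆-injective {x = x} {y} eq = x∈⁅y⁆⇒x≡y y (subst (x ∈ˢ_) eq (x∈⁅x⁆ x))

∁-injective : {S T : Subset n} → ∁ S ≡ ∁ T → S ≡ T
∁-injective {S = S} {T} eq = lookup-ext λ x → not-injective
  (trans (sym (lookup-map x not S)) (trans (cong (λ U → lookup U x) eq) (lookup-map x not T)))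

∣Z-Singletons∣ : ∀ n → n ≢ 1 → ∣Z Singletons n ∣ ≡ n
∣Z-Singletons∣ n n≢1 = ∣Z∣-onlyAt (Singletons n) n≢1 false ⁅_⁆ (∁ ∘ ⁅_⁆) onlyAt-∁⁅⁆
  (∈-tabulate⁺ ⁅_⁆) VecAnyₚ.tabulate⁻ ⁅⁆-injective compare
  where
  weight-⁅⁆ : ∀ S (x : Fin n) → weight S ⁅ x ⁆ ≡ ℕ.suc (indicator (lookup S x))
  weight-⁅⁆ S x = cong₂ _+_ (∣⁅x⁆∣≡1 x) (∣∩⁅⁆∣ S x)
  compare-bits : ∀ a b → ℕ.suc (indicator a) < ℕ.suc (indicator b) ⇔ (a ≡ false × b ≡ true)
  compare-bits false true  = mk⇔ (λ _ → refl , refl) (λ _ → ≤-refl)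
  compare-bits false false = mk⇔ (λ lt → contradiction lt (<-irrefl refl)) (λ ())
  compare-bits true  true  = mk⇔ (λ lt → contradiction lt (<-irrefl refl)) (λ ())
  compare-bits true  false = mk⇔ (λ { (s≤s ()) }) (λ ())
  compare : ∀ S x y → weight S ⁅ x ⁆ < weight S ⁅ y ⁆ ⇔ (lookup S x ≡ false × lookup S y ≡ true)
  compare S x y rewrite weight-⁅⁆ S x | weight-⁅⁆ S y = compare-bits (lookup S x) (lookup S y)

∣Z-CoSingletons∣ : ∀ n → n ≢ 1 → ∣Z CoSingletons n ∣ ≡ n
∣Z-CoSingletons∣ n n≢1 = ∣Z∣-onlyAt (CoSingletons n) n≢1 true (∁ ∘ ⁅_⁆) ⁅_⁆ onlyAt-⁅⁆
  (∈-tabulate⁺ (∁ ∘ ⁅_⁆)) VecAnyₚ.tabulate⁻ (⁅⁆-injective ∘ ∁-injective)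
  λ S x y → compare-bits (lookup S x) (lookup S y) (weight-∁⁅⁆ S x) (weight-∁⁅⁆ S y)
  where
  -- The right-hand side is independent of `x`, so comparing weights amounts to comparing indicators
  -- in reverse.
  weight-∁⁅⁆ : ∀ S (x : Fin n) → weight S (∁ ⁅ x ⁆) + indicator (lookup S x) ≡ (n ∸ 1) + ∣ S ∣
  weight-∁⁅⁆ S x = begin
    ∣ ∁ ⁅ x ⁆ ∣ + ∣ S ∩ ∁ ⁅ x ⁆ ∣ + indicator (lookup S x)
      ≡⟨ +-assoc ∣ ∁ ⁅ x ⁆ ∣ _ _ ⟩
    ∣ ∁ ⁅ x ⁆ ∣ + (∣ S ∩ ∁ ⁅ x ⁆ ∣ + indicator (lookup S x))
      ≡⟨ cong₂ _+_ (trans (∣∁p∣≡n∸∣p∣ ⁅ x ⁆) (cong (n ∸_) (∣⁅x⁆∣≡1 x)))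
                   (trans (cong (∣ S ∩ ∁ ⁅ x ⁆ ∣ +_) (sym (∣∩⁅⁆∣ S x))) (∣∩∁∣+∣∩∣ S ⁅ x ⁆)) ⟩
    (n ∸ 1) + ∣ S ∣ ∎
    where open ≡-Reasoning
  compare-bits : ∀ a b {u v k} → u + indicator a ≡ k → v + indicator b ≡ k →
                 u < v ⇔ (a ≡ true × b ≡ false)
  compare-bits true false {u} {v} p q = mk⇔ (λ _ → refl , refl)
    λ _ → ≤-reflexive (trans (+-comm 1 u) (trans p (trans (sym q) (+-identityʳ v))))
  compare-bits false false {u} {v} p q = mk⇔
    (λ lt → contradiction lt (<-irrefl (+-cancelʳ-≡ 0 u v (trans p (sym q))))) (λ ())
  compare-bits true true {u} {v} p q = mk⇔
    (λ lt → contradiction lt (<-irrefl (+-cancelʳ-≡ 1 u v (trans p (sym q))))) (λ ())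
  compare-bits false true {u} {v} p q = mk⇔
    (λ lt → contradiction
        (≤-reflexive (trans (+-comm 1 v) (trans q (trans (sym p) (+-identityʳ u))))) (<-asym lt)) (λ ())

image-id : (S : Subset n) → image Perm.id S ≡ S
image-id = tabulate∘lookup

≅-id : (H : Hypergraph n m) (G : Hypergraph n m′) → (∀ {e} → e ∈ᵛ edges H → e ∈ᵛ edges G) →
       (∀ {e} → e ∈ᵛ edges G → e ∈ᵛ edges H) → H ≅ G
≅-id H G H⊆G G⊆H = Perm.id , λ e → mk⇔
  (λ e∈H → subst (_∈ᵛ edges G) (sym (image-id e)) (H⊆G e∈H))
  (λ e∈G → G⊆H (subst (_∈ᵛ edges G) (image-id e) e∈G))

module _ (H : Hypergraph n m) (antichain : NoEdgeContainsAnother H) where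

  comparable⇒≡ : ∀ {e f} → e ∈ᵛ edges H → f ∈ᵛ edges H → e ⊆ˢ f → e ≡ f
  comparable⇒≡ {e} {f} e∈H f∈H e⊆f = decidable-stable (e ≟ˢ f) λ e≢f → antichain e∈H f∈H e≢f e⊆f

  -- A nonempty edge contains a singleton edge and must equal it. The vertex `x₀` is there for the
  -- empty edge, which would lie inside the singleton of `x₀`.
  ≅-Singletons : Fin n → (∀ x → ⁅ x ⁆ ∈ᵛ edges H) → H ≅ Singletons n
  ≅-Singletons x₀ ⁅⁆∈H = ≅-id H (Singletons n) singleton λ f∈ →
    let x , f≡ = VecAnyₚ.tabulate⁻ f∈ in subst (_∈ᵛ edges H) (sym f≡) (⁅⁆∈H x)
    where
    singleton : ∀ {e} → e ∈ᵛ edges H → e ∈ᵛ edges (Singletons n)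
    singleton {e} e∈H with any? (_∈? e)
    ... | yes (x , x∈e) = subst (_∈ᵛ _) (comparable⇒≡ (⁅⁆∈H x) e∈H λ y∈ →
                              subst (_∈ˢ e) (sym (x∈⁅y⁆⇒x≡y x y∈)) x∈e)
                            (∈-tabulate⁺ ⁅_⁆ x)
    ... | no  e-empty   = subst (_∈ᵛ _) (sym (comparable⇒≡ e∈H (⁅⁆∈H x₀) λ y∈ →
                              contradiction (_ , y∈) e-empty))
                            (∈-tabulate⁺ ⁅_⁆ x₀)

  ≅-CoSingletons : Fin n → (∀ x → ∁ ⁅ x ⁆ ∈ᵛ edges H) → H ≅ CoSingletons n
  ≅-CoSingletons x₀ ∁⁅⁆∈H = ≅-id H (CoSingletons n) cosingleton λ f∈ →
    let x , f≡ = VecAnyₚ.tabulate⁻ f∈ in subst (_∈ᵛ edges H) (sym f≡) (∁⁅⁆∈H x)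
    where
    cosingleton : ∀ {e} → e ∈ᵛ edges H → e ∈ᵛ edges (CoSingletons n)
    cosingleton {e} e∈H with any? (λ x → ¬? (x ∈? e))
    ... | yes (x , x∉e) = subst (_∈ᵛ _) (sym (comparable⇒≡ e∈H (∁⁅⁆∈H x) λ {y} y∈e →
                              x∉p⇒x∈∁p λ y∈⁅x⁆ → x∉e (subst (_∈ˢ e) (x∈⁅y⁆⇒x≡y x y∈⁅x⁆) y∈e)))
                            (∈-tabulate⁺ (∁ ∘ ⁅_⁆) x)
    ... | no  e-full    = subst (_∈ᵛ _) (comparable⇒≡ (∁⁅⁆∈H x₀) e∈H λ {y} _ →
                              decidable-stable (y ∈? e) λ y∉e → e-full (y , y∉e))
                            (∈-tabulate⁺ (∁ ∘ ⁅_⁆) x₀)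

-- Only the edges of C₄ and its two diagonals are incomparable with all other edges.
comparable-C₄ : (t : Subset 4) → ∣ t ∣ ≡ 2 ⊎ VecAny.Any (λ s → s ≢ t × (s ⊆ˢ t ⊎ t ⊆ˢ s)) (edges C₄)
comparable-C₄ t = All.lookup (from-yes (All.all? comparable? (allSubsets 4))) (∈-allSubsets t)
  where
  comparable? : Decidable (λ t → ∣ t ∣ ≡ 2 ⊎ VecAny.Any (λ s → s ≢ t × (s ⊆ˢ t ⊎ t ⊆ˢ s)) (edges C₄))
  comparable? t = (∣ t ∣ ℕ.≟ 2) ⊎-dec
    VecAny.any? (λ s → ¬? (s ≟ˢ t) ×-dec ((s ⊆? t) ⊎-dec (t ⊆? s))) (edges C₄)

image-reflects-⊆ : ∀ (π : Permutation n n′) {S T} → image π S ⊆ˢ image π T → S ⊆ˢ T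
image-reflects-⊆ π {S} {T} πS⊆πT {x} x∈S = lookup⇒[]= x T
  (trans (sym (lookup-at T)) ([]=⇒lookup (πS⊆πT (lookup⇒[]= _ _ (trans (lookup-at S) ([]=⇒lookup x∈S))))))
  where
  lookup-at : ∀ U → lookup (image π U) (π ⟨$⟩ʳ x) ≡ lookup U x
  lookup-at U = trans (lookup-image π U _) (cong (lookup U) (inverseˡ π))

image-flip : ∀ (π : Permutation n n′) i S → image π (flip (π ⟨$⟩ˡ i) S) ≡ flip i (image π S)
image-flip π i S = lookup-ext pointwise
  where
  pointwise : ∀ j → lookup (image π (flip (π ⟨$⟩ˡ i) S)) j ≡ lookup (flip i (image π S)) j
  pointwise j with j ≟ i
  ... | yes refl = trans (lookup-image π (flip (π ⟨$⟩ˡ i) S) j) (trans (lookup∘updateAt (π ⟨$⟩ˡ j) {f = not} S)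
    (trans (cong not (sym (lookup-image π S j))) (sym (lookup∘updateAt j (image π S)))))
  ... | no j≢i = trans (lookup-image π (flip (π ⟨$⟩ˡ i) S) j) (trans (lookup∘updateAt′ _ _ πj≢πi S)
    (trans (sym (lookup-image π S j)) (sym (lookup∘updateAt′ j i j≢i (image π S)))))
    where
    πj≢πi : π ⟨$⟩ˡ j ≢ π ⟨$⟩ˡ i
    πj≢πi eq = j≢i (trans (sym (inverseʳ π)) (trans (cong (π ⟨$⟩ʳ_) eq) (inverseʳ π)))

-- Carries the edges of a square, given as flips of `e₀`, over to subsets of `Fin 4` that can be
-- evaluated.
image-⊕ : ∀ (π : Permutation n n′) S is → image π (S ⊕ List.map (π ⟨$⟩ˡ_) is) ≡ image π S ⊕ is
image-⊕ π S []       = refl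
image-⊕ π S (i ∷ is) = trans (image-flip π i (S ⊕ List.map (π ⟨$⟩ˡ_) is)) (cong (flip i) (image-⊕ π S is))

module _ (H : Hypergraph n m) (antichain : NoEdgeContainsAnother H)
         (π : Permutation n 4) (images : ∀ {s} → s ∈ᵛ edges C₄ → ∃[ e ] e ∈ᵛ edges H × image π e ≡ s)
         (pairs : ∀ {e} → e ∈ᵛ edges H → ∣ e ∣ ≡ 2 → image π e ∈ᵛ edges C₄) where

  -- An edge whose image does not have size 2 would be comparable with another edge of `H`, namely
  -- the preimage of an edge of `C₄`. For size 2 the hypothesis `pairs` excludes the diagonals.
  ≅-C₄ : H ≅ C₄
  ≅-C₄ = π , λ e → mk⇔ to from
    where
    from : ∀ {e} → image π e ∈ᵛ edges C₄ → e ∈ᵛ edges H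
    from πe∈ = let f , f∈H , πf≡πe = images πe∈ in subst (_∈ᵛ edges H) (image-injective π πf≡πe) f∈H
    to : ∀ {e} → e ∈ᵛ edges H → image π e ∈ᵛ edges C₄
    to {e} e∈H with comparable-C₄ (image π e)
    ... | inj₁ ∣πe∣≡2 = pairs e∈H (trans (sym (∣image∣ π e)) ∣πe∣≡2)
    ... | inj₂ some with fromAny some
    ... | s , s∈C₄ , s≢ , s~ with images s∈C₄
    ... | f , f∈H , refl with s~
    ... | inj₁ f⊆e = contradiction
      (cong (image π) (comparable⇒≡ H antichain f∈H e∈H (image-reflects-⊆ π f⊆e))) s≢
    ... | inj₂ e⊆f = contradiction
      (cong (image π) (sym (comparable⇒≡ H antichain e∈H f∈H (image-reflects-⊆ π e⊆f)))) s≢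

-- The dichotomy for a hypergraph with a chosen edge of minimal size.

module Dichotomy (H : Hypergraph n m) (antichain : NoEdgeContainsAnother H)
                 {e₀ : Subset n} (e₀∈H : e₀ ∈ᵛ edges H)
                 (minimal : ∀ {f} → f ∈ᵛ edges H → ∣ e₀ ∣ ≤ ∣ f ∣) where

  open MinimalEdges H minimal
  balanced : ∀ {x y} → x ≢ y → C (e₀ ⊕ (x ∷ y ∷ [])) → lookup e₀ x ≢ lookup e₀ y
  balanced x≢y (_ , same) = same-size⇒balanced {e = e₀} x≢y same

  open Counting {C = C} {Y = Z H ∘ ∁} C? (Z? H ∘ ∁) complement-versal versal-or-exchange
    {e₀} (e₀∈H , refl) balanced

  plenty⇒∣Z∣ : Plenty → n + 1 ≤ ∣Z H ∣
  plenty⇒∣Z∣ (g , g-injective , g-Y) = subst (_≤ ∣Z H ∣) (+-comm 1 n)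
    (∣Z∣-lower H (∁ ∘ g ∘ number) (λ eq → number-injective (g-injective (∁-injective eq))) (g-Y ∘ number))
    where
    number : Fin (ℕ.suc n) → Maybe (Fin n)
    number zero    = nothing
    number (suc x) = just x
    number-injective : Injective _≡_ _≡_ number
    number-injective {zero}  {zero}  _    = refl
    number-injective {suc _} {suc _} refl = refl

  star⇒≅ : Star → H ≅ Singletons n ⊎ H ≅ CoSingletons n
  star⇒≅ (x , true  , star-C) = inj₁ (≅-Singletons H antichain x λ y → proj₁ (star-C (onlyAt-⁅⁆ y)))
  star⇒≅ (x , false , star-C) = inj₂ (≅-CoSingletons H antichain x λ y → proj₁ (star-C (onlyAt-∁⁅⁆ y)))

  square⇒≅ : Square → H ≅ C₄
  square⇒≅ square = ≅-C₄ H antichain π images pairs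
    where
    open Square square
    corners : List (Fin n)
    corners = v₀ ∷ v₁ ∷ v₂ ∷ v₃ ∷ []
    position : Fin n → Fin 4
    position x = Any.index (cover x)
    corner : Fin 4 → Fin n
    corner = List.lookup corners
    corner-position : ∀ x → corner (position x) ≡ x
    corner-position x = sym (Anyₚ.lookup-index (cover x))
    position-corner : ∀ i → position (corner i) ≡ i
    position-corner i = lookup-injective distinct _ _ (corner-position (corner i))
    π : Permutation n 4
    π = permutation position corner position-corner corner-position
    image-e₀ : image π e₀ ≡ inside ∷ inside ∷ outside ∷ outside ∷ []
    image-e₀ with colors
    ... | c₀ , c₁ , c₂ , c₃ = cong₂ _∷_ c₀ (cong₂ _∷_ c₁ (cong₂ _∷_ c₂ (cong₂ _∷_ c₃ refl)))
    image-e₀⊕ : ∀ is → image π (e₀ ⊕ List.map corner is) ≡ (inside ∷ inside ∷ outside ∷ outside ∷ []) ⊕ is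
    image-e₀⊕ is = trans (image-⊕ π e₀ is) (cong (_⊕ is) image-e₀)
    images : ∀ {s} → s ∈ᵛ edges C₄ → ∃[ e ] e ∈ᵛ edges H × image π e ≡ s
    images (here refl)                         = e₀ , e₀∈H , image-e₀
    images at₂                 = _ , proj₁ e₁₂ , image-e₀⊕ (0F ∷ 2F ∷ [])
    images at₃         = _ , proj₁ e₂₃ , image-e₀⊕ (3F ∷ 1F ∷ 0F ∷ 2F ∷ [])
    images at₄ = _ , proj₁ e₃₀ , image-e₀⊕ (1F ∷ 3F ∷ [])
    ∣e₀∣≡2 : ∣ e₀ ∣ ≡ 2
    ∣e₀∣≡2 = trans (sym (∣image∣ π e₀)) (cong ∣_∣ image-e₀)
    pairs : ∀ {e} → e ∈ᵛ edges H → ∣ e ∣ ≡ 2 → image π e ∈ᵛ edges C₄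
    pairs e∈H ∣e∣≡2 with only (e∈H , trans ∣e∣≡2 (sym ∣e₀∣≡2))
    ... | inj₁ refl                = subst (_∈ᵛ edges C₄) (sym image-e₀) (here refl)
    ... | inj₂ (inj₁ refl)         = subst (_∈ᵛ edges C₄) (sym (image-e₀⊕ (0F ∷ 2F ∷ []))) at₂
    ... | inj₂ (inj₂ (inj₁ refl))  =
      subst (_∈ᵛ edges C₄) (sym (image-e₀⊕ (1F ∷ 3F ∷ []))) at₄
    ... | inj₂ (inj₂ (inj₂ refl))  =
      subst (_∈ᵛ edges C₄) (sym (image-e₀⊕ (3F ∷ 1F ∷ 0F ∷ 2F ∷ []))) at₃

  dichotomy : n + 1 ≤ ∣Z H ∣ ⊎ (H ≅ Singletons n ⊎ H ≅ CoSingletons n ⊎ H ≅ C₄)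
  dichotomy with trichotomy
  ... | inj₁ plenty        = inj₁ (plenty⇒∣Z∣ plenty)
  ... | inj₂ (inj₂ square) = inj₂ (inj₂ (inj₂ (square⇒≅ square)))
  ... | inj₂ (inj₁ star) with star⇒≅ star
  ... | inj₁ ≅S = inj₂ (inj₁ ≅S)
  ... | inj₂ ≅C = inj₂ (inj₂ (inj₁ ≅C))

-- Without edges there are no versals, hence `1 ≤ m` in the lower bound. For `n = 1` the single edge
-- of `Singletons 1` or `CoSingletons 1` makes both subsets versal, hence `n ≢ 1` in the equality.
mainTheorem1 : ∀ {n m : ℕ} (H : Hypergraph n m) → NoEdgeContainsAnother H →
    (1 ≤ m → ¬ (H ≅ Singletons n ⊎ H ≅ CoSingletons n ⊎ H ≅ C₄) → n + 1 ≤ ∣Z H ∣) ×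
    (n ≢ 1 → H ≅ Singletons n ⊎ H ≅ CoSingletons n ⊎ H ≅ C₄ → ∣Z H ∣ ≡ n)
mainTheorem1 {n} H antichain = lower , equality
  where
  lower : 1 ≤ _ → ¬ (H ≅ Singletons n ⊎ H ≅ CoSingletons n ⊎ H ≅ C₄) → n + 1 ≤ ∣Z H ∣
  lower 1≤m unexceptional with minimal-edge (edges H) 1≤m
  ... | e₀ , e₀∈H , minimal with Dichotomy.dichotomy H antichain e₀∈H minimal
  ... | inj₁ n+1≤∣Z∣     = n+1≤∣Z∣
  ... | inj₂ exceptional = contradiction exceptional unexceptional
  equality : n ≢ 1 → H ≅ Singletons n ⊎ H ≅ CoSingletons n ⊎ H ≅ C₄ → ∣Z H ∣ ≡ n
  equality n≢1 (inj₁ ≅S)        = trans (∣Z∣-cong {H = H} {Singletons n} ≅S) (∣Z-Singletons∣ n n≢1)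
  equality n≢1 (inj₂ (inj₁ ≅C)) = trans (∣Z∣-cong {H = H} {CoSingletons n} ≅C) (∣Z-CoSingletons∣ n n≢1)
  -- The count for `C₄` evaluates to 4, and the bijection of vertex sets gives `n = 4`.
  equality _   (inj₂ (inj₂ ≅C)) = trans (∣Z∣-cong {H = H} {C₄} ≅C) (sym (↔⇒≡ (proj₁ ≅C)))
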